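{- Let $m,k$ be integers such that $k$ divides $m$ and $\gcd(2^m-1,2^k+1)=1$, let $e=2^m-2^k-2$ and $d$ such that $de\equiv1\pmod{2^m-1}$. For $\gamma\in\mathbb{F}_{2^k}$ let $\mathcal{A}(\gamma)=\bigcup_{s\in\mathbb{F}_{2^m}:{\rm Tr}^m_k(s)=\gamma}\{(x,sx^{2^k+1}):x\in\mathbb{F}_{2^m}^*\}$, $U=\{(0,y):y\in\mathbb{F}_{2^m}\}$, $\mathcal{B}(\gamma)=\bigcup_{s\in\mathbb{F}_{2^m}:{\rm Tr}^m_k(s)=\gamma}\{(x^{ -d}s,x):x\in\mathbb{F}_{2^m}^*\}$, $V=\{(x,0):x\in\mathbb{F}_{2^m}\}$. I. Every Boolean function on $\mathbb{F}_{2^m}\times\mathbb{F}_{2^m}$ whose support is the union of $2^{k-1}$ of the sets $\mathcal{A}(\gamma)$ is bent; likewise every Boolean function whose support is the union of $U$ and $2^{k-1}$ of the sets $\mathcal{A}(\gamma)$ is bent. II. Every Boolean function whose support is the union of $2^{k-1}$ of the sets $\mathcal{B}(\gamma)$ is bent; likewise every Boolean function whose support is the union of $V$ and $2^{k-1}$ of the sets $\mathcal{B}(\gamma)$ is bent. Moreover, the dual of every bent function in class I belongs to class II, and the dual of every bent function in class II belongs to class I.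
   Context: ${\rm Tr}^m_k$ is the relative trace $\mathbb{F}_{2^m}\to\mathbb{F}_{2^k}$, ${\rm Tr}_m$ the absolute trace; powers of nonzero elements have exponents modulo $2^m-1$. A Boolean function $h$ on $\mathbb{F}_{2^m}\times\mathbb{F}_{2^m}$ is bent if $\mathcal{W}_h(u,v)=\sum_{x,y}(-1)^{h(x,y)\oplus{\rm Tr}_m(ux+vy)}$ has absolute value $2^m$ for all $u,v\in\mathbb{F}_{2^m}$; its dual $h^*$ is the Boolean function defined by $\mathcal{W}_h(u,v)=2^m(-1)^{h^*(u,v)}$. The support of a Boolean function is the set where it takes value $1$. -}

module Defs where

open import Level using (0ℓ)
open import Data.Bool using (Bool; true; false; _xor_)
open import Data.Nat as ℕ using (ℕ; zero; suc; _^_; _∸_)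
open import Data.Integer as ℤ using (ℤ; +_)
open import Data.List using (List; []; _∷_; length; upTo; map)
open import Data.List.Membership.Propositional using (_∈_)
open import Data.List.Relation.Unary.All using (All)
open import Data.List.Relation.Unary.Unique.Propositional using (Unique)
open import Data.Product using (Σ; _×_; _,_; ∃-syntax)
open import Data.Sum using (_⊎_)
open import Relation.Nullary using (¬_; yes; no)
open import Relation.Binary.Definitions using (DecidableEquality)
open import Relation.Binary.PropositionalEquality using (_≡_)
open import Algebra.Structures using (IsCommutativeRing)

record GF2^ (m : ℕ) : Set₁ where
  field
    Carrier : Set
    _≟_     : DecidableEquality Carrier
    _+_ _*_ : Carrier → Carrier → Carrier
    -_      : Carrier → Carrier
    0# 1#   : Carrier
    isCommutativeRing : IsCommutativeRing _≡_ _+_ _*_ -_ 0# 1#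
    1≢0     : ¬ (1# ≡ 0#)
    inv     : Carrier → Carrier
    inv-r   : ∀ x → ¬ (x ≡ 0#) → x * inv x ≡ 1#
    char2   : ∀ x → x + x ≡ 0#
    elems   : List Carrier
    elems-unique   : Unique elems
    elems-complete : ∀ x → x ∈ elems
    elems-length   : length elems ≡ 2 ^ m

module _ {m : ℕ} (F : GF2^ m) where
  open GF2^ F

  infixr 8 _^F_
  _^F_ : Carrier → ℕ → Carrier
  x ^F zero  = 1#
  x ^F suc n = x * (x ^F n)

  sumF : List Carrier → Carrier
  sumF []       = 0#
  sumF (a ∷ as) = a + sumF as

  Tr : Carrier → Carrier
  Tr z = sumF (map (λ i → z ^F (2 ^ i)) (upTo m))

  -- relative trace Tr^m_k(s) = Σ_{i < m/k} s^{2^{k i}}  (n = m/k)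
  RelTr : (k n : ℕ) → Carrier → Carrier
  RelTr k n s = sumF (map (λ i → s ^F (2 ^ (k ℕ.* i))) (upTo n))

  InSubfield : ℕ → Carrier → Set
  InSubfield k γ = γ ^F (2 ^ k) ≡ γ

  -- (-1)^(b ⊕ t) for a Boolean b and a field element t ∈ F_2 = {0,1}
  sign : Bool → Carrier → ℤ
  sign b t with b | t ≟ 0#
  ... | false | yes _ = + 1
  ... | false | no  _ = ℤ.- (+ 1)
  ... | true  | yes _ = ℤ.- (+ 1)
  ... | true  | no  _ = + 1

  sumℤ : List ℤ → ℤ
  sumℤ []       = + 0
  sumℤ (a ∷ as) = a ℤ.+ sumℤ as

  BoolFun : Set
  BoolFun = Carrier → Carrier → Bool

  Walsh : BoolFun → Carrier → Carrier → ℤ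
  Walsh h u v = sumℤ (map (λ x → sumℤ (map (λ y → sign (h x y) (Tr ((u * x) + (v * y)))) elems)) elems)

  Bent : BoolFun → Set
  Bent h = ∀ u v → ℤ.∣ Walsh h u v ∣ ≡ 2 ^ m

  IsDual : BoolFun → BoolFun → Set
  IsDual h g = ∀ u v → Walsh h u v ≡ (+ (2 ^ m)) ℤ.* sign (g u v) 0#

  InA : (k n : ℕ) → Carrier → Carrier → Carrier → Set
  InA k n γ a b = ∃[ s ] (RelTr k n s ≡ γ ×
                   ∃[ x ] (¬ (x ≡ 0#) × a ≡ x × b ≡ s * (x ^F (2 ^ k ℕ.+ 1))))

  InB : (k n d : ℕ) → Carrier → Carrier → Carrier → Set
  InB k n d γ a b = ∃[ s ] (RelTr k n s ≡ γ ×
                   ∃[ x ] (¬ (x ≡ 0#) × a ≡ (inv x ^F d) * s × b ≡ x))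

  GoodΓ : ℕ → List Carrier → Set
  GoodΓ k Γ = Unique Γ × All (InSubfield k) Γ × length Γ ≡ 2 ^ (k ∸ 1)

  _SupportIs_ : BoolFun → (Carrier → Carrier → Set) → Set
  h SupportIs P = ∀ a b → (h a b ≡ true → P a b) × (P a b → h a b ≡ true)

  ClassI : (k n : ℕ) → BoolFun → Set
  ClassI k n h = ∃[ Γ ] (GoodΓ k Γ ×
      ( (h SupportIs (λ a b → ∃[ γ ] (γ ∈ Γ × InA k n γ a b)))
      ⊎ (h SupportIs (λ a b → a ≡ 0# ⊎ ∃[ γ ] (γ ∈ Γ × InA k n γ a b)))))

  ClassII : (k n d : ℕ) → BoolFun → Set
  ClassII k n d h = ∃[ Γ ] (GoodΓ k Γ ×
      ( (h SupportIs (λ a b → ∃[ γ ] (γ ∈ Γ × InB k n d γ a b)))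
      ⊎ (h SupportIs (λ a b → b ≡ 0# ⊎ ∃[ γ ] (γ ∈ Γ × InB k n d γ a b)))))

{-# OPTIONS --safe #-}
module Submission where

-- Write q = 2^k, R for the relative trace, χ for the additive character (-1)^Tr and f for (-1) to the
-- indicator function of Γ.  Off the axis x = 0 a function of class I is f (R (y / P x)) with
-- P x = x^(q+1), so the row of its Walsh sum at x is χ (u x) S (v P x), where
-- S w = Σ_s f (R s) χ (w s).  This S vanishes outside the subfield of order q, because R is invariant
-- under translation by t^q + t, and at 0, because all fibres of R over the subfield have the same size.
-- Reindexing by w = v P x leaves only w in the subfield, where P is the squaring map σ and P⁻¹ is a
-- Frobenius power; hence the sum is Σ_w χ (σ c w) S w with c = u P⁻¹ (1/v), which by orthogonality is
-- 2^m f (σ (R c)).  The dual is therefore again of this shape, with P⁻¹ in place of P, the preimage of Γ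
-- under σ in place of Γ, and the coordinates exchanged.  As P⁻¹ x = x^(-d), that is class II, and the
-- argument is symmetric in P and P⁻¹.

open import Defs
open import Algebra.Bundles using (CommutativeMonoid; CommutativeRing)
import Algebra.Properties.CommutativeSemigroup as CommutativeSemigroupProperties
import Algebra.Properties.Ring as RingProperties
open import Algebra.Structures using (IsCommutativeMonoid)
open import Data.Bool using (Bool; true; false; if_then_else_)
open import Data.Nat using (ℕ; zero; suc; NonZero; _^_; _∸_; _/_; z≤n; s≤s)
import Data.Nat as ℕ
import Data.Nat.Properties as ℕ
import Data.Nat.DivMod as ℕ
open import Data.Nat.Divisibility using (_∣_; divides)
open import Data.Nat.GCD using (gcd)
open import Data.Integer as ℤ using (ℤ; 0ℤ; 1ℤ; -1ℤ)
import Data.Integer.Properties as ℤ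
open import Data.Integer.Divisibility as ℤD using ()
import Data.Integer.Divisibility.Signed as Signed
open import Data.Integer.Solver using (module +-*-Solver)
open import Data.List using (List; []; _∷_; _++_; length; map; filter; foldr; upTo)
import Data.List.Properties as List
open import Data.List.Membership.Propositional using (_∈_; _∉_; find; lose)
open import Data.List.Membership.Propositional.Properties
  using (∈-map⁺; ∈-map⁻; ∈-filter⁺; ∈-filter⁻)
open import Data.List.Membership.Propositional.Properties.WithK using (unique∧set⇒bag)
import Data.List.Membership.DecPropositional as DecMembership
open import Data.List.Relation.Binary.BagAndSetEquality using (∼bag⇒↭)
open import Data.List.Relation.Binary.Permutation.Propositional using (_↭_; ↭⇒↭ₛ)
import Data.List.Relation.Binary.Permutation.Propositional.Properties as ↭
import Data.List.Relation.Binary.Permutation.Setoid.Properties as ↭ₛ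
open import Data.List.Relation.Unary.All as All using (All; []; _∷_)
import Data.List.Relation.Unary.All.Properties as All
open import Data.List.Relation.Unary.AllPairs using ([]; _∷_)
open import Data.List.Relation.Unary.Any as Any using (here; there)
open import Data.List.Relation.Unary.Unique.Propositional using (Unique)
import Data.List.Relation.Unary.Unique.Propositional.Properties as Unique
open import Data.Product using (Σ; _×_; _,_; proj₁; proj₂; ∃-syntax)
open import Data.Sum using (_⊎_; inj₁; inj₂; [_,_]′)
open import Data.Sum.Function.Propositional using (_⊎-⇔_)
open import Data.Vec using (Vec; []; _∷_)
open import Function using (_∘_; flip; _⇔_; mk⇔; Equivalence)
open import Function.Properties.Equivalence using () renaming (refl to ⇔-refl)
open import Relation.Nullary using (¬_; Dec; yes; no; does; ¬?; contradiction; _×-dec_)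
open import Relation.Nullary.Decidable using (dec-true; dec-false)
open import Relation.Binary.PropositionalEquality

-- Duplicate-free lists as finite sets, and counting by fibres

unique⇒↭ : ∀ {A : Set} {xs ys : List A} → Unique xs → Unique ys →
           (∀ {x} → x ∈ xs → x ∈ ys) → (∀ {x} → x ∈ ys → x ∈ xs) → xs ↭ ys
unique⇒↭ xs! ys! xs⊆ys ys⊆xs = ∼bag⇒↭ (unique∧set⇒bag xs! ys! (mk⇔ xs⊆ys ys⊆xs))

foldr-↭ : ∀ {A : Set} {_∙_ : A → A → A} {ε : A} → IsCommutativeMonoid _≡_ _∙_ ε →
          ∀ {xs ys} → xs ↭ ys → foldr _∙_ ε xs ≡ foldr _∙_ ε ys
foldr-↭ {A} M xs↭ys = ↭ₛ.foldr-commMonoid (setoid A) M (↭⇒↭ₛ xs↭ys)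

length-filter-¬ : ∀ {A : Set} {P : A → Set} (P? : ∀ x → Dec (P x)) xs →
                  length (filter P? xs) ℕ.+ length (filter (¬? ∘ P?) xs) ≡ length xs
length-filter-¬ P? [] = refl
length-filter-¬ P? (x ∷ xs) with does (P? x)
... | true  = cong suc (length-filter-¬ P? xs)
... | false = trans (ℕ.+-suc _ _) (cong suc (length-filter-¬ P? xs))

-- Induction on `bs`: the part of `xs` over `b` is a single fibre, and the rest maps into the tail.
-- Upper bounds suffice later, where a known total forces equality.
length-fibres : ∀ {A B : Set} (_≟_ : ∀ (x y : B) → Dec (x ≡ y)) (f : A → B) (D : ℕ) →
                (∀ b xs → Unique xs → All (λ x → f x ≡ b) xs → length xs ℕ.≤ D) →
                ∀ bs xs → Unique xs → All (λ x → f x ∈ bs) xs → length xs ℕ.≤ length bs ℕ.* D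
length-fibres _≟_ f D fibre []       []       xs! []        = z≤n
length-fibres _≟_ f D fibre (b ∷ bs) xs       xs! xs∈ = begin
  length xs                                                       ≡⟨ sym (length-filter-¬ P? xs) ⟩
  length (filter P? xs) ℕ.+ length (filter (¬? ∘ P?) xs)
    ≤⟨ ℕ.+-mono-≤
         (fibre b _ (Unique.filter⁺ P? xs!) (All.all-filter P? xs))
         (length-fibres _≟_ f D fibre bs _ (Unique.filter⁺ (¬? ∘ P?) xs!) (All.tabulate rest)) ⟩
  D ℕ.+ length bs ℕ.* D                                             ∎
  where
  open ℕ.≤-Reasoning
  P? = λ x → f x ≟ b
  rest : ∀ {x} → x ∈ filter (¬? ∘ P?) xs → f x ∈ bs
  rest x∈ with ∈-filter⁻ (¬? ∘ P?) x∈
  ... | x∈xs , fx≢b with All.lookup xs∈ x∈xs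
  ...   | here fx≡b  = contradiction fx≡b fx≢b
  ...   | there fx∈bs = fx∈bs

-- Signs and supports

± : Bool → ℤ
± false = 1ℤ
± true  = -1ℤ

∣±∣ : ∀ b → ℤ.∣ ± b ∣ ≡ 1
∣±∣ false = refl
∣±∣ true  = refl

±-injective : ∀ {b c} → ± b ≡ ± c → b ≡ c
±-injective {false} {false} _ = refl
±-injective {true}  {true}  _ = refl

x≡-x⇒x≡0 : ∀ (x : ℤ) → x ≡ ℤ.- x → x ≡ 0ℤ
-- For every other integer the two sides have different constructors, so no further clause arises.
x≡-x⇒x≡0 (ℤ.+ zero) _ = refl

bool-≡ : ∀ {b c} → (b ≡ true → c ≡ true) → (c ≡ true → b ≡ true) → b ≡ c
bool-≡ {true}          to _    = sym (to refl)
bool-≡ {false} {false} _  _    = refl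
bool-≡ {false} {true}  _  from = from refl

-- Turns a support condition into a pointwise equation: `X` will be membership in a union of sets,
-- `Y` its description through `Region`, and `c` a value of `spread`.
support⇒≡ : ∀ {b c} {X Y : Set} → (b ≡ true → X) × (X → b ≡ true) → X ⇔ Y → c ≡ true ⇔ Y → b ≡ c
support⇒≡ (b⇒X , X⇒b) X⇔Y c⇔Y = bool-≡
  (Equivalence.from c⇔Y ∘ Equivalence.to X⇔Y ∘ b⇒X)
  (X⇒b ∘ Equivalence.from X⇔Y ∘ Equivalence.to c⇔Y)

≡⇒support : ∀ {b c} {X Y : Set} → b ≡ c → X ⇔ Y → c ≡ true ⇔ Y → (b ≡ true → X) × (X → b ≡ true)
≡⇒support refl X⇔Y c⇔Y =
  Equivalence.from X⇔Y ∘ Equivalence.to c⇔Y , Equivalence.from c⇔Y ∘ Equivalence.to X⇔Y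

-- With `suc N` for `2 ^ m` and `b` for `2 ^ k`, the exponent e is N - (b + 1), so d e - 1 = d N -
-- (1 + d (b + 1)), and `N` divides the bracket. This is what makes x^(-d) the inverse of x^(2^k+1).
exponent-∣ : ∀ N b d → (ℤ.+ N) ℤD.∣ ((ℤ.+ d) ℤ.* ((ℤ.+ suc N) ℤ.- (ℤ.+ b) ℤ.- (ℤ.+ 2)) ℤ.- (ℤ.+ 1)) →
             N ∣ suc (d ℕ.* (b ℕ.+ 1))
exponent-∣ N b d N∣ = subst (N ∣_)
  (trans (ℤ.∣-i∣≡∣i∣ (ℤ.suc (ℤ.+ d ℤ.* ℤ.+ (b ℕ.+ 1)))) (cong (λ z → ℤ.∣ ℤ.suc z ∣) (sym (ℤ.pos-* d (b ℕ.+ 1)))))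
  (Signed.∣⇒∣ᵤ (Signed.∣m+n∣m⇒∣n
    (subst (ℤ.+ N Signed.∣_) (expand (ℤ.+ N) (ℤ.+ b) (ℤ.+ d)) (Signed.∣ᵤ⇒∣ N∣))
    (Signed.∣n⇒∣m*n (ℤ.+ d) Signed.∣-refl)))
  where
  open +-*-Solver
  expand : ∀ N b d → d ℤ.* (1ℤ ℤ.+ N ℤ.- b ℤ.- ℤ.+ 2) ℤ.- 1ℤ ≡
                     d ℤ.* N ℤ.+ ℤ.- (1ℤ ℤ.+ d ℤ.* (b ℤ.+ 1ℤ))
  expand = solve 3 (λ N b d →
    d :* (con 1ℤ :+ N :- b :- con (ℤ.+ 2)) :- con 1ℤ
      := d :* N :+ :- (con 1ℤ :+ d :* (b :+ con 1ℤ))) refl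

-- Arithmetic in a finite field of characteristic two

module FiniteField {m : ℕ} (F : GF2^ m) where

  open GF2^ F public
    renaming (_≟_ to infix 4 _≟_; _+_ to infixl 6 _+_; _*_ to infixl 7 _*_)

  commutativeRing : CommutativeRing _ _
  commutativeRing = record { isCommutativeRing = isCommutativeRing }

  open CommutativeRing commutativeRing public
    using (ring; +-comm; +-assoc; +-identityˡ; +-identityʳ; *-comm; *-assoc; *-identityˡ; *-identityʳ;
           distribˡ; distribʳ; zeroˡ; zeroʳ; *-isCommutativeMonoid;
           +-commutativeMonoid; *-commutativeMonoid)
  open CommutativeSemigroupProperties
    (CommutativeMonoid.commutativeSemigroup *-commutativeMonoid) public
    using () renaming (interchange to *-interchange; x∙yz≈y∙xz to x*yz≡y*xz)
  open CommutativeSemigroupProperties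
    (CommutativeMonoid.commutativeSemigroup +-commutativeMonoid) public
    using () renaming (interchange to +-interchange)
  open RingProperties ring public using () renaming (+-cancelˡ to +-cancelˡ)

  infixr 8 _↑_
  _↑_ : Carrier → ℕ → Carrier
  _↑_ = _^F_ F

  open ≡-Reasoning

  +≡0⇒≡ : ∀ {x y} → x + y ≡ 0# → x ≡ y
  +≡0⇒≡ {x} {y} x+y≡0 = +-cancelˡ y x y (trans (+-comm y x) (trans x+y≡0 (sym (char2 y))))

  inv-l : ∀ {x} → x ≢ 0# → inv x * x ≡ 1#
  inv-l x≢0 = trans (*-comm _ _) (inv-r _ x≢0)

  inv-cancel : ∀ {x} y → x ≢ 0# → x * (inv x * y) ≡ y
  inv-cancel {x} y x≢0 = trans (sym (*-assoc _ _ _)) (trans (cong (_* y) (inv-r x x≢0)) (*-identityˡ y))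

  inv-cancel′ : ∀ {x} y → x ≢ 0# → inv x * (x * y) ≡ y
  inv-cancel′ {x} y x≢0 = trans (sym (*-assoc _ _ _)) (trans (cong (_* y) (inv-l x≢0)) (*-identityˡ y))

  inv-cancelʳ : ∀ {x} y → x ≢ 0# → (y * inv x) * x ≡ y
  inv-cancelʳ y x≢0 = trans (*-assoc _ _ _) (trans (cong (y *_) (inv-l x≢0)) (*-identityʳ y))

  inv-cancelʳ′ : ∀ {x} y → x ≢ 0# → (y * x) * inv x ≡ y
  inv-cancelʳ′ y x≢0 = trans (*-assoc _ _ _) (trans (cong (y *_) (inv-r _ x≢0)) (*-identityʳ y))

  *-cancelˡ : ∀ {x y z} → x ≢ 0# → x * y ≡ x * z → y ≡ z
  *-cancelˡ {x} {y} {z} x≢0 eq = begin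
    y                ≡⟨ inv-cancel′ y x≢0 ⟨
    inv x * (x * y)  ≡⟨ cong (inv x *_) eq ⟩
    inv x * (x * z)  ≡⟨ inv-cancel′ z x≢0 ⟩
    z                ∎

  *≡0 : ∀ {x y} → x ≢ 0# → x * y ≡ 0# → y ≡ 0#
  *≡0 {x} x≢0 eq = *-cancelˡ x≢0 (trans eq (sym (zeroʳ x)))

  *-≢0 : ∀ {x y} → x ≢ 0# → y ≢ 0# → x * y ≢ 0#
  *-≢0 x≢0 y≢0 = y≢0 ∘ *≡0 x≢0

  inv-unique : ∀ {x y} → x * y ≡ 1# → y ≡ inv x
  inv-unique {x} {y} xy≡1 = *-cancelˡ x≢0 (trans xy≡1 (sym (inv-r x x≢0)))
    where
    x≢0 : x ≢ 0#
    x≢0 refl = 1≢0 (trans (sym xy≡1) (zeroˡ y))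

  inv-≢0 : ∀ {x} → x ≢ 0# → inv x ≢ 0#
  inv-≢0 {x} x≢0 eq = 1≢0 (trans (sym (inv-r x x≢0)) (trans (cong (x *_) eq) (zeroʳ x)))

  1↑ : ∀ n → 1# ↑ n ≡ 1#
  1↑ zero    = refl
  1↑ (suc n) = trans (*-identityˡ _) (1↑ n)

  ↑-+ : ∀ x a b → x ↑ (a ℕ.+ b) ≡ x ↑ a * x ↑ b
  ↑-+ x zero    b = sym (*-identityˡ _)
  ↑-+ x (suc a) b = trans (cong (x *_) (↑-+ x a b)) (sym (*-assoc _ _ _))

  *-↑ : ∀ x y n → (x * y) ↑ n ≡ x ↑ n * y ↑ n
  *-↑ x y zero    = sym (*-identityˡ _)
  *-↑ x y (suc n) = trans (cong ((x * y) *_) (*-↑ x y n)) (*-interchange _ _ _ _)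

  ↑-* : ∀ x a b → x ↑ (a ℕ.* b) ≡ (x ↑ a) ↑ b
  ↑-* x zero    b = sym (1↑ b)
  ↑-* x (suc a) b = begin
    x ↑ (b ℕ.+ a ℕ.* b)       ≡⟨ ↑-+ x b (a ℕ.* b) ⟩
    x ↑ b * x ↑ (a ℕ.* b)     ≡⟨ cong (x ↑ b *_) (↑-* x a b) ⟩
    x ↑ b * (x ↑ a) ↑ b       ≡⟨ *-↑ x (x ↑ a) b ⟨
    (x * x ↑ a) ↑ b           ∎

  ↑-≢0 : ∀ {x} n → x ≢ 0# → x ↑ n ≢ 0#
  ↑-≢0 zero    x≢0 = 1≢0
  ↑-≢0 (suc n) x≢0 = *-≢0 x≢0 (↑-≢0 n x≢0)

  inv-↑ : ∀ {x} n → x ≢ 0# → inv (x ↑ n) ≡ inv x ↑ n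
  inv-↑ {x} n x≢0 = sym (inv-unique (begin
    x ↑ n * inv x ↑ n  ≡⟨ *-↑ x (inv x) n ⟨
    (x * inv x) ↑ n    ≡⟨ cong (_↑ n) (inv-r x x≢0) ⟩
    1# ↑ n             ≡⟨ 1↑ n ⟩
    1#                 ∎))

  -- Powers of the Frobenius map

  frob : ℕ → Carrier → Carrier
  frob i x = x ↑ (2 ^ i)

  frob-0 : ∀ x → frob 0 x ≡ x
  frob-0 = *-identityʳ

  frob-suc : ∀ i x → frob (suc i) x ≡ frob i (x ↑ 2)
  frob-suc i x = ↑-* x 2 (2 ^ i)

  frob-∘ : ∀ i j x → frob (i ℕ.+ j) x ≡ frob j (frob i x)
  frob-∘ i j x = trans (cong (x ↑_) (ℕ.^-distribˡ-+-* 2 i j)) (↑-* x (2 ^ i) (2 ^ j))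

  frob-comm : ∀ i j x → frob i (frob j x) ≡ frob j (frob i x)
  frob-comm i j x =
    trans (sym (frob-∘ j i x)) (trans (cong (λ l → frob l x) (ℕ.+-comm j i)) (frob-∘ i j x))

  frob-* : ∀ i x y → frob i (x * y) ≡ frob i x * frob i y
  frob-* i x y = *-↑ x y (2 ^ i)

  square-+ : ∀ x y → (x + y) ↑ 2 ≡ x ↑ 2 + y ↑ 2
  square-+ x y = begin
    (x + y) * ((x + y) * 1#)               ≡⟨ cong ((x + y) *_) (*-identityʳ _) ⟩
    (x + y) * (x + y)                      ≡⟨ distribʳ (x + y) x y ⟩
    x * (x + y) + y * (x + y)              ≡⟨ cong₂ _+_ (distribˡ x x y) (distribˡ y x y) ⟩
    (x * x + x * y) + (y * x + y * y)      ≡⟨ cong (λ z → (x * x + x * y) + (z + y * y)) (*-comm y x) ⟩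
    (x * x + x * y) + (x * y + y * y)      ≡⟨ +-assoc _ _ _ ⟩
    x * x + (x * y + (x * y + y * y))      ≡⟨ cong ((x * x) +_) (+-assoc _ _ _) ⟨
    x * x + ((x * y + x * y) + y * y)      ≡⟨ cong (λ z → x * x + (z + y * y)) (char2 _) ⟩
    x * x + (0# + y * y)                   ≡⟨ cong ((x * x) +_) (+-identityˡ _) ⟩
    x * x + y * y
      ≡⟨ cong₂ _+_ (cong (x *_) (*-identityʳ x)) (cong (y *_) (*-identityʳ y)) ⟨
    x * (x * 1#) + y * (y * 1#)            ∎

  frob-+ : ∀ i x y → frob i (x + y) ≡ frob i x + frob i y
  frob-+ zero    x y = trans (frob-0 _) (sym (cong₂ _+_ (frob-0 x) (frob-0 y)))
  frob-+ (suc i) x y = begin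
    frob (suc i) (x + y)               ≡⟨ frob-suc i (x + y) ⟩
    frob i ((x + y) ↑ 2)               ≡⟨ cong (frob i) (square-+ x y) ⟩
    frob i (x ↑ 2 + y ↑ 2)             ≡⟨ frob-+ i _ _ ⟩
    frob i (x ↑ 2) + frob i (y ↑ 2)    ≡⟨ cong₂ _+_ (frob-suc i x) (frob-suc i y) ⟨
    frob (suc i) x + frob (suc i) y    ∎

  frob-0# : ∀ i → frob i 0# ≡ 0#
  frob-0# i = begin
    frob i 0#              ≡⟨ cong (frob i) (+-identityˡ 0#) ⟨
    frob i (0# + 0#)       ≡⟨ frob-+ i 0# 0# ⟩
    frob i 0# + frob i 0#  ≡⟨ char2 _ ⟩
    0#                     ∎

  -- Fermat: multiplication by x permutes the list of nonzero elements.

  nonzeros : List Carrier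
  nonzeros = filter (λ x → ¬? (x ≟ 0#)) elems

  nonzeros-unique : Unique nonzeros
  nonzeros-unique = Unique.filter⁺ (λ x → ¬? (x ≟ 0#)) elems-unique

  ∈-nonzeros⁺ : ∀ {x} → x ≢ 0# → x ∈ nonzeros
  ∈-nonzeros⁺ {x} x≢0 = ∈-filter⁺ (λ x → ¬? (x ≟ 0#)) (elems-complete x) x≢0

  ∈-nonzeros⁻ : ∀ {x} → x ∈ nonzeros → x ≢ 0#
  ∈-nonzeros⁻ x∈ = proj₂ (∈-filter⁻ (λ x → ¬? (x ≟ 0#)) {xs = elems} x∈)

  length-nonzeros : suc (length nonzeros) ≡ 2 ^ m
  length-nonzeros = trans (↭.↭-length 0∷nonzeros↭elems) elems-length
    where
    split : ∀ x → x ∈ 0# ∷ nonzeros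
    split x with x ≟ 0#
    ... | yes x≡0 = here x≡0
    ... | no  x≢0 = there (∈-nonzeros⁺ x≢0)
    0∷nonzeros↭elems : 0# ∷ nonzeros ↭ elems
    0∷nonzeros↭elems = unique⇒↭
      (All.tabulate (λ x∈ → ≢-sym (∈-nonzeros⁻ x∈)) ∷ nonzeros-unique) elems-unique
      (λ {x} _ → elems-complete x) (λ {x} _ → split x)

  scale-nonzeros : ∀ {a} → a ≢ 0# → map (a *_) nonzeros ↭ nonzeros
  scale-nonzeros {a} a≢0 = unique⇒↭ (Unique.map⁺ (*-cancelˡ a≢0) nonzeros-unique) nonzeros-unique to from
    where
    to : ∀ {x} → x ∈ map (a *_) nonzeros → x ∈ nonzeros
    to x∈ with ∈-map⁻ (a *_) x∈
    ... | y , y∈ , refl = ∈-nonzeros⁺ (*-≢0 a≢0 (∈-nonzeros⁻ y∈))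
    from : ∀ {x} → x ∈ nonzeros → x ∈ map (a *_) nonzeros
    from {x} x∈ = subst (_∈ map (a *_) nonzeros) (inv-cancel x a≢0)
      (∈-map⁺ (a *_) (∈-nonzeros⁺ (*-≢0 (inv-≢0 a≢0) (∈-nonzeros⁻ x∈))))

  ∏ : List Carrier → Carrier
  ∏ = foldr _*_ 1#

  ∏-scale : ∀ a xs → ∏ (map (a *_) xs) ≡ a ↑ length xs * ∏ xs
  ∏-scale a []       = sym (*-identityˡ 1#)
  ∏-scale a (x ∷ xs) = trans (cong ((a * x) *_) (∏-scale a xs)) (*-interchange _ _ _ _)

  ∏-≢0 : ∀ {xs} → All (_≢ 0#) xs → ∏ xs ≢ 0#
  ∏-≢0 []            = 1≢0
  ∏-≢0 (x≢0 ∷ xs≢0) = *-≢0 x≢0 (∏-≢0 xs≢0)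

  fermat : ∀ {a} → a ≢ 0# → a ↑ (2 ^ m ∸ 1) ≡ 1#
  fermat {a} a≢0 = subst (λ l → a ↑ l ≡ 1#) (cong (_∸ 1) length-nonzeros)
    (*-cancelˡ (∏-≢0 (All.tabulate ∈-nonzeros⁻)) (begin
      ∏ nonzeros * a ↑ length nonzeros  ≡⟨ *-comm _ _ ⟩
      a ↑ length nonzeros * ∏ nonzeros  ≡⟨ ∏-scale a nonzeros ⟨
      ∏ (map (a *_) nonzeros)           ≡⟨ foldr-↭ *-isCommutativeMonoid (scale-nonzeros a≢0) ⟩
      ∏ nonzeros                        ≡⟨ *-identityʳ _ ⟨
      ∏ nonzeros * 1#                   ∎))

  frob-m : ∀ x → frob m x ≡ x
  frob-m x with x ≟ 0#
  ... | yes refl = frob-0# m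
  ... | no x≢0  = begin
    -- `length-nonzeros` exhibits `2 ^ m` as the successor of `2 ^ m ∸ 1`, which splits off one
    -- factor `x`.
    x ↑ (2 ^ m)
      ≡⟨ cong (x ↑_) (trans (sym length-nonzeros) (cong suc (cong (_∸ 1) length-nonzeros))) ⟩
    x * x ↑ (2 ^ m ∸ 1)        ≡⟨ cong (x *_) (fermat x≢0) ⟩
    x * 1#                     ≡⟨ *-identityʳ x ⟩
    x                          ∎

  -- Because `frob m` is the identity, complementary Frobenius powers are mutually inverse. Inverse
  -- powers and square roots are always written in this way, with natural exponents.
  frob-inverse : ∀ i j → i ℕ.+ j ≡ m → ∀ x → frob j (frob i x) ≡ x
  frob-inverse i j i+j≡m x = trans (sym (frob-∘ i j x)) (trans (cong (λ l → frob l x) i+j≡m) (frob-m x))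

  -- A field with `2 ^ 0` elements would identify `0#` and `1#`.
  m≢0 : m ≢ 0
  m≢0 refl = 1≢0 (singleton elems elems-length (elems-complete 1#) (elems-complete 0#))
    where
    singleton : ∀ xs → length xs ≡ 1 → ∀ {x y} → x ∈ xs → y ∈ xs → x ≡ y
    singleton (_ ∷ []) _ (here p) (here q) = trans p (sym q)

  -- Roots of monic polynomials

  -- A vector of length d represents the monic polynomial of degree d with these lower coefficients.

  eval : ∀ {d} → Vec Carrier d → Carrier → Carrier
  eval []       x = 1#
  eval (c ∷ cs) x = c + x * eval cs x

  -- Synthetic division by x - a, written `x + a` in characteristic two: the value at `a` of the
  -- tail of the coefficients becomes the constant coefficient of the quotient.
  factor : ∀ {d} (p : Vec Carrier (suc d)) a →
           Σ (Vec Carrier d) λ q → ∀ x → eval p x + eval p a ≡ (x + a) * eval q x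
  factor (c ∷ []) a = [] , λ x → begin
    (c + x * 1#) + (c + a * 1#)   ≡⟨ +-interchange _ _ _ _ ⟩
    (c + c) + (x * 1# + a * 1#)   ≡⟨ cong (_+ (x * 1# + a * 1#)) (char2 c) ⟩
    0# + (x * 1# + a * 1#)        ≡⟨ +-identityˡ _ ⟩
    x * 1# + a * 1#               ≡⟨ distribʳ 1# x a ⟨
    (x + a) * 1#                  ∎
  factor (c ∷ p@(_ ∷ _)) a with factor p a
  ... | q , p≡ = (eval p a ∷ q) , λ x → begin
    (c + x * eval p x) + (c + a * eval p a)  ≡⟨ +-interchange _ _ _ _ ⟩
    (c + c) + (x * eval p x + a * eval p a)  ≡⟨ cong (_+ (x * eval p x + a * eval p a)) (char2 c) ⟩
    0# + (x * eval p x + a * eval p a)       ≡⟨ +-identityˡ _ ⟩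
    x * eval p x + a * eval p a              ≡⟨ cong (λ z → x * z + a * eval p a) (p-x x) ⟩
    x * (eval p a + (x + a) * eval q x) + a * eval p a
      ≡⟨ cong (_+ (a * eval p a)) (trans (distribˡ x _ _) (+-comm _ _)) ⟩
    (x * ((x + a) * eval q x) + x * eval p a) + a * eval p a
      ≡⟨ +-assoc _ _ _ ⟩
    x * ((x + a) * eval q x) + (x * eval p a + a * eval p a)
      ≡⟨ cong₂ _+_ (x*yz≡y*xz x (x + a) (eval q x)) (sym (distribʳ (eval p a) x a)) ⟩
    (x + a) * (x * eval q x) + (x + a) * eval p a
      ≡⟨ distribˡ (x + a) _ _ ⟨
    (x + a) * (x * eval q x + eval p a)      ≡⟨ cong ((x + a) *_) (+-comm _ _) ⟩
    (x + a) * (eval p a + x * eval q x)      ∎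
    where
    p-x : ∀ x → eval p x ≡ eval p a + (x + a) * eval q x
    p-x x = begin
      eval p x                              ≡⟨ +-identityˡ _ ⟨
      0# + eval p x                         ≡⟨ cong (_+ eval p x) (char2 (eval p a)) ⟨
      (eval p a + eval p a) + eval p x      ≡⟨ +-assoc _ _ _ ⟩
      eval p a + (eval p a + eval p x)      ≡⟨ cong (eval p a +_) (trans (+-comm _ _) (p≡ x)) ⟩
      eval p a + (x + a) * eval q x         ∎

  -- Dividing by the factor of the first root lowers the degree by one, and the other listed
  -- elements, being different from that root, are roots of the quotient.
  length-roots : ∀ {d} (p : Vec Carrier d) xs → Unique xs → All (λ x → eval p x ≡ 0#) xs → length xs ℕ.≤ d
  length-roots p      []       _          _                 = z≤n
  length-roots []     (a ∷ xs) _          (1≡0 ∷ _)         = contradiction 1≡0 1≢0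
  length-roots p@(_ ∷ _) (a ∷ xs) (a∉xs ∷ xs!) (pa≡0 ∷ pxs≡0) with factor p a
  ... | q , p≡ = s≤s (length-roots q xs xs! (All.tabulate root))
    where
    root : ∀ {x} → x ∈ xs → eval q x ≡ 0#
    root {x} x∈ = *≡0 (λ x+a≡0 → All.lookup a∉xs x∈ (sym (+≡0⇒≡ x+a≡0))) (begin
      (x + a) * eval q x       ≡⟨ p≡ x ⟨
      eval p x + eval p a      ≡⟨ cong₂ _+_ (All.lookup pxs≡0 x∈) pa≡0 ⟩
      0# + 0#                  ≡⟨ +-identityˡ 0# ⟩
      0#                       ∎)

  -- Here the vector has no implicit leading 1. Such polynomials are closed under addition and can
  -- be added to a monic one without spoiling its leading term.
  evalLow : ∀ {d} → Vec Carrier d → Carrier → Carrier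
  evalLow []       x = 0#
  evalLow (c ∷ cs) x = c + x * evalLow cs x

  Monic : ℕ → (Carrier → Carrier) → Set
  Monic d f = Σ (Vec Carrier d) λ p → ∀ x → eval p x ≡ f x

  DegreeBelow : ℕ → (Carrier → Carrier) → Set
  DegreeBelow d f = Σ (Vec Carrier d) λ p → ∀ x → evalLow p x ≡ f x

  below-0 : ∀ d → DegreeBelow d (λ _ → 0#)
  below-0 zero    = [] , λ _ → refl
  below-0 (suc d) = let p , p≡ = below-0 d in
    (0# ∷ p) , λ x → trans (+-identityˡ _) (trans (cong (x *_) (p≡ x)) (zeroʳ x))

  below-const : ∀ {d} c → 0 ℕ.< d → DegreeBelow d (λ _ → c)
  below-const {suc d} c _ = let p , p≡ = below-0 d in
    (c ∷ p) , λ x → trans (cong (c +_) (trans (cong (x *_) (p≡ x)) (zeroʳ x))) (+-identityʳ c)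

  below-↑ : ∀ {i d} → i ℕ.< d → DegreeBelow d (_↑ i)
  below-↑ {zero}  0<d               = below-const 1# 0<d
  below-↑ {suc i} {suc d} (s≤s i<d) = let p , p≡ = below-↑ i<d in
    (0# ∷ p) , λ x → trans (+-identityˡ _) (cong (x *_) (p≡ x))

  below-+ : ∀ {d f g} → DegreeBelow d f → DegreeBelow d g → DegreeBelow d (λ x → f x + g x)
  below-+ {f = f} {g} (p , p≡) (q , q≡) =
    let r , r≡ = add p q in r , λ x → trans (r≡ x) (cong₂ _+_ (p≡ x) (q≡ x))
    where
    add : ∀ {d} (p q : Vec Carrier d) → DegreeBelow d (λ x → evalLow p x + evalLow q x)
    add []      []      = [] , λ _ → sym (+-identityˡ 0#)
    add (a ∷ p) (b ∷ q) = let r , r≡ = add p q in (a + b ∷ r) , λ x →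
      trans (cong (λ z → a + b + x * z) (r≡ x))
        (trans (cong ((a + b) +_) (distribˡ x _ _)) (+-interchange _ _ _ _))

  monic-↑ : ∀ d → Monic d (_↑ d)
  monic-↑ zero    = [] , λ _ → refl
  monic-↑ (suc d) = let p , p≡ = monic-↑ d in
    (0# ∷ p) , λ x → trans (+-identityˡ _) (cong (x *_) (p≡ x))

  monic-+ : ∀ {d f g} → DegreeBelow d f → Monic d g → Monic d (λ x → f x + g x)
  monic-+ {f = f} {g} (p , p≡) (q , q≡) =
    let r , r≡ = add p q in r , λ x → trans (r≡ x) (cong₂ _+_ (p≡ x) (q≡ x))
    where
    add : ∀ {d} (p q : Vec Carrier d) → Monic d (λ x → evalLow p x + eval q x)
    add []      []      = [] , λ _ → sym (+-identityˡ 1#)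
    add (a ∷ p) (b ∷ q) = let r , r≡ = add p q in (a + b ∷ r) , λ x →
      trans (cong (λ z → a + b + x * z) (r≡ x))
        (trans (cong ((a + b) +_) (distribˡ x _ _)) (+-interchange _ _ _ _))

  monic-roots : ∀ {d f} → Monic d f → ∀ xs → Unique xs → All (λ x → f x ≡ 0#) xs → length xs ℕ.≤ d
  monic-roots (p , p≡) xs xs! fxs≡0 = length-roots p xs xs! (All.map (λ {x} → trans (p≡ x)) fxs≡0)

  -- Traces

  sumF-hom : ∀ (φ : Carrier → Carrier) → φ 0# ≡ 0# → (∀ x y → φ (x + y) ≡ φ x + φ y) →
             ∀ (g : ℕ → Carrier) is → φ (sumF F (map g is)) ≡ sumF F (map (φ ∘ g) is)
  sumF-hom φ φ0 φ+ g []       = φ0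
  sumF-hom φ φ0 φ+ g (i ∷ is) = trans (φ+ _ _) (cong (φ (g i) +_) (sumF-hom φ φ0 φ+ g is))

  sumF-+ : ∀ (f g : ℕ → Carrier) is →
           sumF F (map (λ i → f i + g i) is) ≡ sumF F (map f is) + sumF F (map g is)
  sumF-+ f g []       = sym (+-identityˡ 0#)
  sumF-+ f g (i ∷ is) = trans (cong ((f i + g i) +_) (sumF-+ f g is)) (+-interchange _ _ _ _)

  sumF-cong : ∀ {f g : ℕ → Carrier} → (∀ i → f i ≡ g i) → ∀ is → sumF F (map f is) ≡ sumF F (map g is)
  sumF-cong f≗g is = cong (sumF F) (List.map-cong f≗g is)

  sumF-first : ∀ (g : ℕ → Carrier) n →
               sumF F (map g (upTo (suc n))) ≡ g 0 + sumF F (map (g ∘ suc) (upTo n))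
  sumF-first g n = cong (λ xs → g 0 + sumF F xs)
    (trans (List.map-applyUpTo suc g n) (sym (List.map-upTo (g ∘ suc) n)))

  -- `upTo` unfolds at index 0, whereas the cyclic shift of a trace and the degree of its polynomial
  -- both need the top summand.
  sumF-last : ∀ (g : ℕ → Carrier) n →
              sumF F (map g (upTo (suc n))) ≡ sumF F (map g (upTo n)) + g n
  sumF-last g zero    = +-comm _ _
  sumF-last g (suc n) = begin
    sumF F (map g (upTo (suc (suc n))))                   ≡⟨ sumF-first g (suc n) ⟩
    g 0 + sumF F (map (g ∘ suc) (upTo (suc n)))           ≡⟨ cong (g 0 +_) (sumF-last (g ∘ suc) n) ⟩
    g 0 + (sumF F (map (g ∘ suc) (upTo n)) + g (suc n))   ≡⟨ +-assoc _ _ _ ⟨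
    g 0 + sumF F (map (g ∘ suc) (upTo n)) + g (suc n)     ≡⟨ cong (_+ g (suc n)) (sumF-first g n) ⟨
    sumF F (map g (upTo (suc n))) + g (suc n)             ∎

  module RelativeTrace (k n : ℕ) .{{_ : NonZero k}} (k*n≡m : k ℕ.* n ≡ m) where

    R : Carrier → Carrier
    R = RelTr F k n

    R-+ : ∀ s t → R (s + t) ≡ R s + R t
    R-+ s t = trans (sumF-cong (λ i → frob-+ (k ℕ.* i) s t) (upTo n)) (sumF-+ _ _ (upTo n))

    frob-R : ∀ i s → frob i (R s) ≡ R (frob i s)
    frob-R i s = trans (sumF-hom (frob i) (frob-0# i) (frob-+ i) _ (upTo n))
      (sumF-cong (λ j → frob-comm i (k ℕ.* j) s) (upTo n))

    -- Applying `frob k` shifts the summands by one index. Splitting the sum of n + 1 summands at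
    -- either end compares the two traces, and the end terms agree because `frob (k ℕ.* n)` is
    -- `frob m`.
    R-frob-k : ∀ s → R (frob k s) ≡ R s
    R-frob-k s = +-cancelˡ (g 0) _ _ (begin
      g 0 + R (frob k s)                         ≡⟨ cong (g 0 +_) (sumF-cong shift (upTo n)) ⟩
      g 0 + sumF F (map (g ∘ suc) (upTo n))      ≡⟨ sumF-first g n ⟨
      sumF F (map g (upTo (suc n)))              ≡⟨ sumF-last g n ⟩
      R s + g n                                  ≡⟨ +-comm _ _ ⟩
      g n + R s                                  ≡⟨ cong (_+ R s) g-n≡g-0 ⟩
      g 0 + R s                                  ∎)
      where
      g : ℕ → Carrier
      g i = frob (k ℕ.* i) s
      shift : ∀ i → frob (k ℕ.* i) (frob k s) ≡ g (suc i)
      shift i = trans (sym (frob-∘ k (k ℕ.* i) s)) (cong (λ l → frob l s) (sym (ℕ.*-suc k i)))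
      g-n≡g-0 : g n ≡ g 0
      g-n≡g-0 = begin
        frob (k ℕ.* n) s  ≡⟨ cong (λ l → frob l s) k*n≡m ⟩
        frob m s          ≡⟨ frob-m s ⟩
        s                 ≡⟨ frob-0 s ⟨
        frob 0 s          ≡⟨ cong (λ l → frob l s) (ℕ.*-zeroʳ k) ⟨
        frob (k ℕ.* 0) s  ∎

    R-InSubfield : ∀ s → InSubfield F k (R s)
    R-InSubfield s = trans (frob-R k s) (R-frob-k s)

    InSubfield⇒frob-multiple : ∀ {w} → InSubfield F k w → ∀ i → frob (k ℕ.* i) w ≡ w
    InSubfield⇒frob-multiple {w} w∈ zero    = trans (cong (λ l → frob l w) (ℕ.*-zeroʳ k)) (frob-0 w)
    InSubfield⇒frob-multiple {w} w∈ (suc i) = begin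
      frob (k ℕ.* suc i) w           ≡⟨ cong (λ l → frob l w) (ℕ.*-suc k i) ⟩
      frob (k ℕ.+ k ℕ.* i) w         ≡⟨ frob-∘ k (k ℕ.* i) w ⟩
      frob (k ℕ.* i) (frob k w)      ≡⟨ cong (frob (k ℕ.* i)) w∈ ⟩
      frob (k ℕ.* i) w               ≡⟨ InSubfield⇒frob-multiple w∈ i ⟩
      w                              ∎

    frob-InSubfield : ∀ i {w} → InSubfield F k w → InSubfield F k (frob i w)
    frob-InSubfield i {w} w∈ = trans (frob-comm k i w) (cong (frob i) w∈)

    -- The elements are roots of x^(2^k) + x, which is monic of degree `2 ^ k` since `k` is
    -- positive.
    length-subfield : ∀ xs → Unique xs → All (InSubfield F k) xs → length xs ℕ.≤ 2 ^ k
    length-subfield xs xs! xs∈ = monic-roots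
      (monic-+ (below-↑ (ℕ.^-monoʳ-< 2 (s≤s (s≤s z≤n)) (ℕ.>-nonZero⁻¹ k))) (monic-↑ (2 ^ k)))
      xs xs! (All.map (λ {x} x∈ → trans (cong₂ _+_ (*-identityʳ x) x∈) (char2 x)) xs∈)

  module RelativeTraceDegree (k n : ℕ) .{{_ : NonZero k}} where

    private
      R : Carrier → Carrier
      R = RelTr F k (suc n)

    -- The last summand of the trace, of exponent `2 ^ (k ℕ.* n)`, dominates the earlier ones and
    -- the constant. Taking `suc n` summands makes it visible.
    monic-R : ∀ γ → Monic (2 ^ (k ℕ.* n)) (λ s → γ + R s)
    monic-R γ = let p , p≡ = monic-+ (below-+ (below-const γ (ℕ.m^n>0 2 (k ℕ.* n))) (below-sum n ℕ.≤-refl))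
                               (monic-↑ (2 ^ (k ℕ.* n)))
      in p , λ s → trans (p≡ s) (trans (+-assoc _ _ _) (cong (γ +_) (sym (sumF-last _ n))))
      where
      below-sum :
        ∀ l → l ℕ.≤ n → DegreeBelow (2 ^ (k ℕ.* n)) (λ s → sumF F (map (λ i → frob (k ℕ.* i) s) (upTo l)))
      below-sum zero    _   = below-0 _
      below-sum (suc l) l<n =
        let p , p≡ = below-+ (below-sum l (ℕ.<⇒≤ l<n))
                       (below-↑ (ℕ.^-monoʳ-< 2 (s≤s (s≤s z≤n)) (ℕ.*-monoʳ-< k l<n)))
        in p , λ s → trans (p≡ s) (sym (sumF-last _ l))

    length-fibre : ∀ γ xs → Unique xs → All (λ s → R s ≡ γ) xs → length xs ℕ.≤ 2 ^ (k ℕ.* n)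
    length-fibre γ xs xs! Rxs≡γ = monic-roots (monic-R γ) xs xs!
      (All.map (λ R≡γ → trans (cong (γ +_) R≡γ) (char2 γ)) Rxs≡γ)

  -- The absolute trace is the relative trace to the prime field, so its additivity, Frobenius
  -- invariance and range are instances of the general facts.
  module AbsTr = RelativeTrace 1 m (ℕ.*-identityˡ m)

  tr : Carrier → Carrier
  tr = Tr F

  tr≡RelTr : ∀ z → tr z ≡ RelTr F 1 m z
  tr≡RelTr z = sumF-cong (λ i → cong (λ l → frob l z) (sym (ℕ.*-identityˡ i))) (upTo m)

  tr-+ : ∀ x y → tr (x + y) ≡ tr x + tr y
  tr-+ x y =
    trans (tr≡RelTr (x + y)) (trans (AbsTr.R-+ x y) (cong₂ _+_ (sym (tr≡RelTr x)) (sym (tr≡RelTr y))))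

  tr-0# : tr 0# ≡ 0#
  tr-0# = trans (cong tr (sym (+-identityˡ 0#))) (trans (tr-+ 0# 0#) (char2 _))

  tr-square : ∀ z → tr (z ↑ 2) ≡ tr z
  tr-square z = trans (tr≡RelTr _) (trans (AbsTr.R-frob-k z) (sym (tr≡RelTr z)))

  tr-frob : ∀ i z → tr (frob i z) ≡ tr z
  tr-frob zero    z = cong tr (frob-0 z)
  tr-frob (suc i) z = trans (cong tr (frob-suc i z)) (trans (tr-frob i (z ↑ 2)) (tr-square z))

  -- `InSubfield F 1` says that the trace equals its own square, and a nonzero idempotent of a field
  -- is 1.
  tr-binary : ∀ z → tr z ≢ 0# → tr z ≡ 1#
  tr-binary z t≢0 = *-cancelˡ t≢0 (begin
    tr z * tr z  ≡⟨ cong (tr z *_) (*-identityʳ _) ⟨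
    tr z ↑ 2     ≡⟨ cong (_↑ 2) (tr≡RelTr z) ⟩
    RelTr F 1 m z ↑ 2  ≡⟨ AbsTr.R-InSubfield z ⟩
    RelTr F 1 m z      ≡⟨ tr≡RelTr z ⟨
    tr z         ≡⟨ *-identityʳ _ ⟨
    tr z * 1#    ∎)

  -- Otherwise all 2^m elements would be roots of the trace polynomial, whose degree is only
  -- 2^(m-1).
  tr-nontrivial : ∃[ t ] tr t ≢ 0#
  tr-nontrivial with Any.any? (λ t → ¬? (tr t ≟ 0#)) elems
  ... | yes found = let t , _ , t≢0 = find found in t , t≢0
  ... | no  none  = contradiction (degenerate m refl) m≢0
    where
    vanishes : ∀ x → tr x ≡ 0#
    vanishes x with tr x ≟ 0#
    ... | yes tx≡0 = tx≡0
    ... | no  tx≢0 = contradiction (lose (elems-complete x) tx≢0) none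
    -- The field is indexed by `m`, so the case distinction is made on a copy `l`, which exposes the
    -- degree `2 ^ l`.
    degenerate : ∀ l → m ≡ l → l ≡ 0
    degenerate zero    _       = refl
    degenerate (suc l) m≡1+l = contradiction bound (ℕ.<⇒≱ (ℕ.^-monoʳ-< 2 (s≤s (s≤s z≤n)) (ℕ.n<1+n l)))
      where
      bound : 2 ^ suc l ℕ.≤ 2 ^ l
      bound = subst₂ ℕ._≤_
        (trans elems-length (cong (2 ^_) m≡1+l)) (cong (2 ^_) (ℕ.*-identityˡ l))
        (RelativeTraceDegree.length-fibre 1 l 0# elems elems-unique
          (All.tabulate (λ {x} _ → subst (λ j → RelTr F 1 j x ≡ 0#) m≡1+l (trans (sym (tr≡RelTr x)) (vanishes x)))))

  tr-nondegenerate : ∀ {c} → c ≢ 0# → ∃[ t ] tr (c * t) ≡ 1#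
  tr-nondegenerate {c} c≢0 = let t , t≢0 = tr-nontrivial in
    inv c * t , trans (cong tr (inv-cancel t c≢0)) (tr-binary t t≢0)

  -- Character sums

  sumℤ-↭ : ∀ {xs ys} → xs ↭ ys → sumℤ F xs ≡ sumℤ F ys
  sumℤ-↭ {xs} {ys} xs↭ys =
    trans (asFoldr xs) (trans (foldr-↭ ℤ.+-0-isCommutativeMonoid xs↭ys) (sym (asFoldr ys)))
    where
    asFoldr : ∀ xs → sumℤ F xs ≡ foldr ℤ._+_ 0ℤ xs
    asFoldr []       = refl
    asFoldr (x ∷ xs) = cong (ℤ._+_ x) (asFoldr xs)

  ∑[_] : List Carrier → (Carrier → ℤ) → ℤ
  ∑[ xs ] f = sumℤ F (map f xs)

  ∑ : (Carrier → ℤ) → ℤ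
  ∑ = ∑[ elems ]

  ∑-cong : ∀ {f g} → (∀ x → f x ≡ g x) → ∑ f ≡ ∑ g
  ∑-cong f≗g = cong (sumℤ F) (List.map-cong f≗g elems)

  ∑[]-* : ∀ c f xs → c ℤ.* ∑[ xs ] f ≡ ∑[ xs ] (λ x → c ℤ.* f x)
  ∑[]-* c f []       = ℤ.*-zeroʳ c
  ∑[]-* c f (x ∷ xs) = trans (ℤ.*-distribˡ-+ c (f x) _)
    (cong (λ z → c ℤ.* f x ℤ.+ z) (∑[]-* c f xs))

  ∑-* : ∀ c f → c ℤ.* ∑ f ≡ ∑ (λ x → c ℤ.* f x)
  ∑-* c f = ∑[]-* c f elems

  ∑[]-+ : ∀ f g xs → ∑[ xs ] (λ x → f x ℤ.+ g x) ≡ ∑[ xs ] f ℤ.+ ∑[ xs ] g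
  ∑[]-+ f g []       = refl
  ∑[]-+ f g (x ∷ xs) = trans (cong (λ z → f x ℤ.+ g x ℤ.+ z) (∑[]-+ f g xs))
    (ℤ-interchange (f x) (g x) _ _)
    where
    open CommutativeSemigroupProperties ℤ.+-commutativeSemigroup using () renaming (interchange to ℤ-interchange)

  ∑[]-0 : ∀ xs → ∑[ xs ] (λ _ → 0ℤ) ≡ 0ℤ
  ∑[]-0 []       = refl
  ∑[]-0 (x ∷ xs) = trans (ℤ.+-identityˡ _) (∑[]-0 xs)

  ∑-swap : ∀ (f : Carrier → Carrier → ℤ) → ∑ (λ x → ∑ (f x)) ≡ ∑ (λ y → ∑ (λ x → f x y))
  ∑-swap f = swap elems
    where
    swap : ∀ xs → ∑[ xs ] (λ x → ∑ (f x)) ≡ ∑ (λ y → ∑[ xs ] (λ x → f x y))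
    swap []       = sym (∑[]-0 elems)
    swap (x ∷ xs) = trans (cong (ℤ._+_ (∑ (f x))) (swap xs)) (sym (∑[]-+ (f x) _ elems))

  ∑-1 : ∑ (λ _ → 1ℤ) ≡ ℤ.+ (2 ^ m)
  ∑-1 = trans (count elems) (cong (λ l → ℤ.+ l) elems-length)
    where
    count : ∀ xs → ∑[ xs ] (λ _ → 1ℤ) ≡ ℤ.+ length xs
    count []       = refl
    count (x ∷ xs) = cong (ℤ._+_ 1ℤ) (count xs)

  ∑-point : ∀ f c → (∀ x → x ≢ c → f x ≡ 0ℤ) → ∑ f ≡ f c
  ∑-point f c f≡0 = point elems elems-unique (elems-complete c)
    where
    vanish : ∀ xs → All (c ≢_) xs → ∑[ xs ] f ≡ 0ℤ
    vanish []       []            = refl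
    vanish (x ∷ xs) (c≢x ∷ c∉xs) = cong₂ ℤ._+_ (f≡0 x (≢-sym c≢x)) (vanish xs c∉xs)
    point : ∀ xs → Unique xs → c ∈ xs → ∑[ xs ] f ≡ f c
    point (x ∷ xs) (x∉xs ∷ xs!) (here refl) = trans (cong (ℤ._+_ (f c)) (vanish xs x∉xs)) (ℤ.+-identityʳ _)
    point (x ∷ xs) (x∉xs ∷ xs!) (there c∈)  =
      trans (cong₂ ℤ._+_ (f≡0 x (All.lookup x∉xs c∈)) (point xs xs! c∈)) (ℤ.+-identityˡ _)

  ∑-reindex : ∀ (φ φ⁻¹ : Carrier → Carrier) → (∀ x → φ⁻¹ (φ x) ≡ x) → (∀ x → φ (φ⁻¹ x) ≡ x) →
              ∀ f → ∑ f ≡ ∑ (f ∘ φ)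
  ∑-reindex φ φ⁻¹ left right f = begin
    ∑ f                              ≡⟨ sumℤ-↭ (↭.map⁺ f elems↭) ⟩
    sumℤ F (map f (map φ elems))     ≡⟨ cong (sumℤ F) (List.map-∘ elems) ⟨
    ∑ (f ∘ φ)                        ∎
    where
    elems↭ : elems ↭ map φ elems
    elems↭ = unique⇒↭ elems-unique
      (Unique.map⁺ (λ {x} {y} eq → trans (sym (left x)) (trans (cong φ⁻¹ eq) (left y))) elems-unique)
      (λ {x} _ → subst (_∈ map φ elems) (right x) (∈-map⁺ φ (elems-complete (φ⁻¹ x))))
      (λ {x} _ → elems-complete x)

  -- Translation by `t` permutes the field, so the sum equals its own negative.
  ∑-antiperiodic : ∀ f t → (∀ x → f (x + t) ≡ ℤ.- f x) → ∑ f ≡ 0ℤ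
  ∑-antiperiodic f t anti = x≡-x⇒x≡0 _ (begin
    ∑ f                          ≡⟨ ∑-reindex (_+ t) (_+ t) cancel cancel f ⟩
    ∑ (λ x → f (x + t))          ≡⟨ ∑-cong (λ x → trans (anti x) (sym (ℤ.-1*i≡-i (f x)))) ⟩
    ∑ (λ x → -1ℤ ℤ.* f x)        ≡⟨ ∑-* -1ℤ f ⟨
    -1ℤ ℤ.* ∑ f                  ≡⟨ ℤ.-1*i≡-i (∑ f) ⟩
    ℤ.- ∑ f                      ∎)
    where
    cancel : ∀ x → x + t + t ≡ x
    cancel x = trans (+-assoc x t t) (trans (cong (x +_) (char2 t)) (+-identityʳ x))

  -- Exchanging the order of summation; this lets class II be treated as functions of the same shape
  -- as class I.
  Walsh-flip : ∀ h u v → Walsh F (flip h) v u ≡ Walsh F h u v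
  Walsh-flip h u v = trans (∑-swap (λ y x → sign F (h x y) (tr (v * y + u * x))))
    (∑-cong (λ x → ∑-cong (λ y → cong (sign F (h x y) ∘ tr) (+-comm (v * y) (u * x)))))

  sign-≡0 : ∀ {t} → t ≡ 0# → sign F false t ≡ 1ℤ
  sign-≡0 {t} t≡0 with t ≟ 0#
  ... | yes _   = refl
  ... | no  t≢0 = contradiction t≡0 t≢0

  sign-≢0 : ∀ {t} → t ≢ 0# → sign F false t ≡ -1ℤ
  sign-≢0 {t} t≢0 with t ≟ 0#
  ... | yes t≡0 = contradiction t≡0 t≢0
  ... | no  _   = refl

  sign-± : ∀ b t → sign F b t ≡ ± b ℤ.* sign F false t
  sign-± false t = sym (ℤ.*-identityˡ _)
  sign-± true  t with t ≟ 0#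
  ... | yes _ = refl
  ... | no  _ = refl

  sign-0# : ∀ b → sign F b 0# ≡ ± b
  sign-0# b = trans (sign-± b 0#) (trans (cong (± b ℤ.*_) (sign-≡0 refl)) (ℤ.*-identityʳ _))

  χ : Carrier → ℤ
  χ z = sign F false (tr z)

  χ-0# : χ 0# ≡ 1ℤ
  χ-0# = sign-≡0 tr-0#

  χ-tr≡1 : ∀ {z} → tr z ≡ 1# → χ z ≡ -1ℤ
  χ-tr≡1 tz≡1 = sign-≢0 (λ tz≡0 → 1≢0 (trans (sym tz≡1) tz≡0))

  χ-+ : ∀ x y → χ (x + y) ≡ χ x ℤ.* χ y
  χ-+ x y = trans (cong (sign F false) (tr-+ x y)) cases
    where
    cases : sign F false (tr x + tr y) ≡ χ x ℤ.* χ y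
    cases with tr x ≟ 0#
    ... | yes tx≡0 =
      trans (cong (sign F false) (trans (cong (_+ tr y) tx≡0) (+-identityˡ _))) (sym (ℤ.*-identityˡ _))
    ... | no  tx≢0 with tr y ≟ 0#
    ...   | yes ty≡0 = sign-≢0 (λ eq → tx≢0 (trans (sym (trans (cong (tr x +_) ty≡0) (+-identityʳ _))) eq))
    ...   | no  ty≢0 = sign-≡0 (trans (cong₂ _+_ (tr-binary x tx≢0) (tr-binary y ty≢0)) (char2 1#))

  χ-frob : ∀ i z → χ (frob i z) ≡ χ z
  χ-frob i z = cong (sign F false) (tr-frob i z)

  -- Nondegeneracy of the trace gives a `t` with `tr (c * t) ≡ 1#`, and translation by it reverses
  -- every sign.
  ∑-χ-≢0 : ∀ {c} → c ≢ 0# → ∑ (λ x → χ (c * x)) ≡ 0ℤ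
  ∑-χ-≢0 {c} c≢0 = let t , tct≡1 = tr-nondegenerate c≢0 in
    ∑-antiperiodic _ t (λ x → begin
      χ (c * (x + t))            ≡⟨ cong χ (distribˡ c x t) ⟩
      χ (c * x + c * t)          ≡⟨ χ-+ _ _ ⟩
      χ (c * x) ℤ.* χ (c * t)    ≡⟨ cong (χ (c * x) ℤ.*_) (χ-tr≡1 tct≡1) ⟩
      χ (c * x) ℤ.* -1ℤ          ≡⟨ ℤ.*-comm _ -1ℤ ⟩
      -1ℤ ℤ.* χ (c * x)          ≡⟨ ℤ.-1*i≡-i _ ⟩
      ℤ.- χ (c * x)              ∎)

  ∑-χ-≡0 : ∀ {c} → c ≡ 0# → ∑ (λ x → χ (c * x)) ≡ ℤ.+ (2 ^ m)
  ∑-χ-≡0 refl = trans (∑-cong (λ x → trans (cong χ (zeroˡ x)) χ-0#)) ∑-1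

  -- The sum counts the elements failing `P` minus those satisfying it.
  ∑-± : ∀ {P : Carrier → Set} (P? : ∀ x → Dec (P x)) →
        length (filter P? elems) ≡ length (filter (¬? ∘ P?) elems) → ∑ (λ x → ± (does (P? x))) ≡ 0ℤ
  ∑-± P? eq = trans (count elems) (trans
    (cong (λ l → ℤ.+ l ℤ.- ℤ.+ length (filter P? elems)) (sym eq))
    (ℤ.+-inverseʳ (ℤ.+ length (filter P? elems))))
    where
    count : ∀ xs → ∑[ xs ] (λ x → ± (does (P? x))) ≡
            ℤ.+ length (filter (¬? ∘ P?) xs) ℤ.- ℤ.+ length (filter P? xs)
    count [] = refl
    count (x ∷ xs) with does (P? x)
    ... | false = trans (cong (ℤ._+_ 1ℤ) (count xs))
        (sym (ℤ.+-assoc 1ℤ (ℤ.+ length (filter (¬? ∘ P?) xs)) (ℤ.- (ℤ.+ length (filter P? xs)))))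
    ... | true  = begin
      -1ℤ ℤ.+ ∑[ xs ] (λ x → ± (does (P? x)))      ≡⟨ cong (ℤ._+_ -1ℤ) (count xs) ⟩
      -1ℤ ℤ.+ (ℤ.+ b ℤ.- ℤ.+ a)                    ≡⟨ ℤ.+-comm -1ℤ (ℤ.+ b ℤ.- ℤ.+ a) ⟩
      ℤ.+ b ℤ.- ℤ.+ a ℤ.+ -1ℤ                      ≡⟨ ℤ.+-assoc (ℤ.+ b) (ℤ.- (ℤ.+ a)) -1ℤ ⟩
      ℤ.+ b ℤ.+ (ℤ.- (ℤ.+ a) ℤ.+ -1ℤ)
        ≡⟨ cong (ℤ._+_ (ℤ.+ b)) (trans (ℤ.+-comm (ℤ.- (ℤ.+ a)) -1ℤ) (sym (ℤ.neg-distrib-+ 1ℤ (ℤ.+ a)))) ⟩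
      ℤ.+ b ℤ.- ℤ.+ suc a                          ∎
      where
      a b : ℕ
      a = length (filter P? xs)
      b = length (filter (¬? ∘ P?) xs)

  -- Walsh transforms

  module Spread (k n : ℕ) .{{_ : NonZero k}} (k*[1+n]≡m : k ℕ.* suc n ≡ m) where

    open RelativeTrace k (suc n) k*[1+n]≡m public
    open RelativeTraceDegree k n public
    open DecMembership _≟_ public using (_∈?_)

    k+k*n≡m : k ℕ.+ k ℕ.* n ≡ m
    k+k*n≡m = trans (sym (ℕ.*-suc k n)) k*[1+n]≡m

    S : (Carrier → ℤ) → Carrier → ℤ
    S f w = ∑ (λ s → f (R s) ℤ.* χ (w * s))

    -- Translating by u = t^(2^k) + t does not change R s, and Tr (w u) = Tr ((w' + w) t) where w' ≠ w
    -- is the image of w under the inverse of x ↦ x^(2^k).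
    S-outside : ∀ f {w} → ¬ InSubfield F k w → S f w ≡ 0ℤ
    S-outside f {w} w∉ = ∑-antiperiodic _ u (λ s → begin
      f (R (s + u)) ℤ.* χ (w * (s + u))          ≡⟨ cong₂ (λ y z → f y ℤ.* χ z) (R-s+u s) (distribˡ w s u) ⟩
      f (R s) ℤ.* χ (w * s + w * u)              ≡⟨ cong (f (R s) ℤ.*_) (χ-+ _ _) ⟩
      f (R s) ℤ.* (χ (w * s) ℤ.* χ (w * u))
        ≡⟨ cong (λ z → f (R s) ℤ.* (χ (w * s) ℤ.* z)) (χ-tr≡1 tr-wu) ⟩
      f (R s) ℤ.* (χ (w * s) ℤ.* -1ℤ)            ≡⟨ ℤ.*-assoc (f (R s)) (χ (w * s)) -1ℤ ⟨
      f (R s) ℤ.* χ (w * s) ℤ.* -1ℤ              ≡⟨ ℤ.*-comm (f (R s) ℤ.* χ (w * s)) -1ℤ ⟩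
      -1ℤ ℤ.* (f (R s) ℤ.* χ (w * s))            ≡⟨ ℤ.-1*i≡-i _ ⟩
      ℤ.- (f (R s) ℤ.* χ (w * s))                ∎)
      where
      w′ : Carrier
      w′ = frob (k ℕ.* n) w
      w′+w≢0 : w′ + w ≢ 0#
      w′+w≢0 eq = w∉ (begin
        frob k w   ≡⟨ cong (frob k) (+≡0⇒≡ eq) ⟨
        frob k w′  ≡⟨ frob-inverse (k ℕ.* n) k (trans (ℕ.+-comm _ k) k+k*n≡m) w ⟩
        w          ∎)
      t : Carrier
      t = proj₁ (tr-nondegenerate w′+w≢0)
      u : Carrier
      u = frob k t + t
      R-s+u : ∀ s → R (s + u) ≡ R s
      R-s+u s = begin
        R (s + u)                    ≡⟨ R-+ s u ⟩
        R s + R (frob k t + t)       ≡⟨ cong (R s +_) (R-+ _ t) ⟩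
        R s + (R (frob k t) + R t)   ≡⟨ cong (λ z → R s + (z + R t)) (R-frob-k t) ⟩
        R s + (R t + R t)            ≡⟨ cong (R s +_) (char2 _) ⟩
        R s + 0#                     ≡⟨ +-identityʳ _ ⟩
        R s                          ∎
      tr-wu : tr (w * u) ≡ 1#
      tr-wu = begin
        tr (w * (frob k t + t))                       ≡⟨ cong tr (distribˡ w _ t) ⟩
        tr (w * frob k t + w * t)                     ≡⟨ tr-+ _ _ ⟩
        tr (w * frob k t) + tr (w * t)                ≡⟨ cong (_+ tr (w * t)) (tr-frob (k ℕ.* n) _) ⟨
        tr (frob (k ℕ.* n) (w * frob k t)) + tr (w * t)
          ≡⟨ cong (λ z → tr z + tr (w * t)) (trans (frob-* (k ℕ.* n) w _)
               (cong (w′ *_) (frob-inverse k (k ℕ.* n) k+k*n≡m t))) ⟩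
        tr (w′ * t) + tr (w * t)                      ≡⟨ tr-+ _ _ ⟨
        tr (w′ * t + w * t)                           ≡⟨ cong tr (distribʳ t w′ w) ⟨
        tr ((w′ + w) * t)                             ≡⟨ proj₂ (tr-nondegenerate w′+w≢0) ⟩
        1#                                            ∎

    -- Sets containing half of the subfield

    ind : List Carrier → Carrier → ℤ
    ind Γ γ = ± (does (γ ∈? Γ))

    2*2^[k-1] : 2 ^ (k ∸ 1) ℕ.+ 2 ^ (k ∸ 1) ≡ 2 ^ k
    2*2^[k-1] = trans (cong (2 ^ (k ∸ 1) ℕ.+_) (sym (ℕ.+-identityʳ _))) (cong (2 ^_) (ℕ.suc-pred k))

    module _ {Γ : List Carrier} (good : GoodΓ F k Γ) where

      private
        Γ! = proj₁ good
        Γ⊆ = proj₁ (proj₂ good)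

      complementΓ : List Carrier
      complementΓ = filter (λ γ → (frob k γ ≟ γ) ×-dec ¬? (γ ∈? Γ)) elems

      ∈-complementΓ⁻ : ∀ {γ} → γ ∈ complementΓ → InSubfield F k γ × γ ∉ Γ
      ∈-complementΓ⁻ = proj₂ ∘ ∈-filter⁻ (λ γ → (frob k γ ≟ γ) ×-dec ¬? (γ ∈? Γ)) {xs = elems}

      -- `Γ` and `complementΓ` are disjoint inside a subfield of at most `2 ^ k` elements, and `Γ`
      -- already takes `2 ^ (k ∸ 1)` of them.
      length-complementΓ : length complementΓ ℕ.≤ 2 ^ (k ∸ 1)
      length-complementΓ = ℕ.+-cancelˡ-≤ (2 ^ (k ∸ 1)) _ _ (subst₂ ℕ._≤_
        (trans (List.length-++ Γ) (cong (ℕ._+ length complementΓ) (proj₂ (proj₂ good))))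
        (sym 2*2^[k-1])
        (length-subfield (Γ ++ complementΓ)
          (Unique.++⁺ Γ! (Unique.filter⁺ _ elems-unique) (λ (γ∈Γ , γ∈c) → proj₂ (∈-complementΓ⁻ γ∈c) γ∈Γ))
          (All.++⁺ Γ⊆ (All.tabulate (proj₁ ∘ ∈-complementΓ⁻)))))

      -- Both halves have at most half of the elements, because every fibre of R has at most 2^(kn) elements.
      length-preimages :
        length (filter (λ s → R s ∈? Γ) elems) ≡ length (filter (λ s → ¬? (R s ∈? Γ)) elems)
      length-preimages =
        trans (balanced a b a≤K b≤K a+b) (sym (balanced b a b≤K a≤K (trans (ℕ.+-comm b a) a+b)))
        where
        a b K : ℕ
        a = length (filter (λ s → R s ∈? Γ) elems)
        b = length (filter (λ s → ¬? (R s ∈? Γ)) elems)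
        K = 2 ^ (k ∸ 1) ℕ.* 2 ^ (k ℕ.* n)
        a≤K : a ℕ.≤ K
        a≤K = subst (λ l → a ℕ.≤ l ℕ.* 2 ^ (k ℕ.* n)) (proj₂ (proj₂ good))
          (length-fibres _≟_ R _ length-fibre Γ _ (Unique.filter⁺ _ elems-unique)
            (All.all-filter (λ s → R s ∈? Γ) elems))
        b≤K : b ℕ.≤ K
        -- Trace values lie in the subfield, so those outside `Γ` lie in `complementΓ`.
        b≤K = ℕ.≤-trans
          (length-fibres _≟_ R _ length-fibre complementΓ _ (Unique.filter⁺ _ elems-unique)
            (All.map (λ {s} Rs∉ → ∈-filter⁺ _ (elems-complete (R s)) (R-InSubfield s , Rs∉))
              (All.all-filter (λ s → ¬? (R s ∈? Γ)) elems)))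
          (ℕ.*-monoˡ-≤ (2 ^ (k ℕ.* n)) length-complementΓ)
        a+b : a ℕ.+ b ≡ K ℕ.+ K
        a+b = begin
          a ℕ.+ b                                             ≡⟨ length-filter-¬ (λ s → R s ∈? Γ) elems ⟩
          length elems                                        ≡⟨ elems-length ⟩
          2 ^ m                                               ≡⟨ cong (2 ^_) k+k*n≡m ⟨
          2 ^ (k ℕ.+ k ℕ.* n)                                 ≡⟨ ℕ.^-distribˡ-+-* 2 k (k ℕ.* n) ⟩
          2 ^ k ℕ.* 2 ^ (k ℕ.* n)                             ≡⟨ cong (ℕ._* 2 ^ (k ℕ.* n)) 2*2^[k-1] ⟨
          (2 ^ (k ∸ 1) ℕ.+ 2 ^ (k ∸ 1)) ℕ.* 2 ^ (k ℕ.* n)      ≡⟨ ℕ.*-distribʳ-+ _ (2 ^ (k ∸ 1)) _ ⟩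
          K ℕ.+ K                                             ∎
        balanced : ∀ a b → a ℕ.≤ K → b ℕ.≤ K → a ℕ.+ b ≡ K ℕ.+ K → a ≡ K
        balanced a b a≤K b≤K a+b≡K+K = ℕ.≤-antisym a≤K
          (ℕ.+-cancelʳ-≤ K K a (subst (ℕ._≤ a ℕ.+ K) a+b≡K+K (ℕ.+-monoʳ-≤ a b≤K)))

      S-0# : S (ind Γ) 0# ≡ 0ℤ
      S-0# = trans
        (∑-cong (λ s → trans (cong (ind Γ (R s) ℤ.*_) (trans (cong χ (zeroˡ s)) χ-0#)) (ℤ.*-identityʳ _)))
        (∑-± (λ s → R s ∈? Γ) length-preimages)

    -- All that the Walsh computation uses about x^(2^k+1) and its inverse. Apart from `P-subfield`,
    -- whose counterpart for `Q` is derived, the fields are symmetric in `P` and `Q`, so one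
    -- computation serves both classes.
    record Pairing : Set where
      field
        P Q       : Carrier → Carrier
        i j       : ℕ
        i+j≡m     : i ℕ.+ j ≡ m
        P-0#      : P 0# ≡ 0#
        Q-0#      : Q 0# ≡ 0#
        Q-P       : ∀ x → Q (P x) ≡ x
        P-Q       : ∀ x → P (Q x) ≡ x
        P-*       : ∀ x y → P (x * y) ≡ P x * P y
        Q-*       : ∀ x y → Q (x * y) ≡ Q x * Q y
        P-subfield : ∀ {w} → InSubfield F k w → P w ≡ frob i w

      -- `frob j w` stays in the subfield, where `P` acts as `frob i` and hence sends it back to
      -- `w`; now apply `Q`.
      Q-subfield : ∀ {w} → InSubfield F k w → Q w ≡ frob j w
      Q-subfield {w} w∈ = begin
        Q w                    ≡⟨ cong Q (frob-inverse j i (trans (ℕ.+-comm j i) i+j≡m) w) ⟨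
        Q (frob i (frob j w))  ≡⟨ cong Q (P-subfield (frob-InSubfield j w∈)) ⟨
        Q (P (frob j w))       ≡⟨ Q-P _ ⟩
        frob j w               ∎

      P-≢0 : ∀ {x} → x ≢ 0# → P x ≢ 0#
      P-≢0 {x} x≢0 Px≡0 = x≢0 (trans (sym (Q-P x)) (trans (cong Q Px≡0) Q-0#))

      Q-≢0 : ∀ {x} → x ≢ 0# → Q x ≢ 0#
      Q-≢0 {x} x≢0 Qx≡0 = x≢0 (trans (sym (P-Q x)) (trans (cong P Qx≡0) P-0#))

      Q-inv : ∀ {x} → x ≢ 0# → Q (inv x) ≡ inv (Q x)
      Q-inv {x} x≢0 = inv-unique (begin
        Q x * Q (inv x)  ≡⟨ Q-* x (inv x) ⟨
        Q (x * inv x)    ≡⟨ cong Q (inv-r x x≢0) ⟩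
        -- `1↑ (2 ^ k)` is the proof that `1#` lies in the subfield.
        Q 1#             ≡⟨ Q-subfield (1↑ (2 ^ k)) ⟩
        frob j 1#        ≡⟨ 1↑ (2 ^ j) ⟩
        1#               ∎)

    flipPairing : Pairing → Pairing
    flipPairing π = record
      { P = Q ; Q = P ; i = j ; j = i ; i+j≡m = trans (ℕ.+-comm j i) i+j≡m
      ; P-0# = Q-0# ; Q-0# = P-0# ; Q-P = P-Q ; P-Q = Q-P ; P-* = Q-* ; Q-* = P-*
      ; P-subfield = Q-subfield }
      where open Pairing π

    -- The common shape of both classes; in class II the coordinates are exchanged.
    spread : (Carrier → Carrier) → List Carrier → Bool → BoolFun F
    spread P Γ ε x y = if does (x ≟ 0#) then ε else does (R (y * inv (P x)) ∈? Γ)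

    spread-≡0 : ∀ P Γ ε {x} → x ≡ 0# → ∀ y → spread P Γ ε x y ≡ ε
    spread-≡0 P Γ ε {x} x≡0 y =
      cong (λ b → if b then ε else does (R (y * inv (P x)) ∈? Γ)) (dec-true (x ≟ 0#) x≡0)

    spread-≢0 : ∀ P Γ ε {x} → x ≢ 0# → ∀ y → spread P Γ ε x y ≡ does (R (y * inv (P x)) ∈? Γ)
    spread-≢0 P Γ ε {x} x≢0 y =
      cong (λ b → if b then ε else does (R (y * inv (P x)) ∈? Γ)) (dec-false (x ≟ 0#) x≢0)

    -- The Walsh transform and the dual of a spread function

    module _ (π : Pairing) {Γ : List Carrier} (good : GoodΓ F k Γ) (ε : Bool)
             {h : BoolFun F} (h≡ : ∀ x y → h x y ≡ spread (Pairing.P π) Γ ε x y) where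

      open Pairing π

      rowSum : Carrier → Carrier → Carrier → ℤ
      rowSum u v x = ∑ (λ y → sign F (h x y) (tr (u * x + v * y)))

      rowSum-χ : ∀ u v x → rowSum u v x ≡ χ (u * x) ℤ.* ∑ (λ y → ± (h x y) ℤ.* χ (v * y))
      rowSum-χ u v x = trans (∑-cong pointwise) (sym (∑-* (χ (u * x)) _))
        where
        open CommutativeSemigroupProperties ℤ.*-commutativeSemigroup using (x∙yz≈y∙xz)
        pointwise : ∀ y → sign F (h x y) (tr (u * x + v * y)) ≡ χ (u * x) ℤ.* (± (h x y) ℤ.* χ (v * y))
        pointwise y = begin
          sign F (h x y) (tr (u * x + v * y))              ≡⟨ sign-± (h x y) _ ⟩
          ± (h x y) ℤ.* χ (u * x + v * y)                  ≡⟨ cong (± (h x y) ℤ.*_) (χ-+ _ _) ⟩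
          ± (h x y) ℤ.* (χ (u * x) ℤ.* χ (v * y))
            ≡⟨ x∙yz≈y∙xz (± (h x y)) (χ (u * x)) (χ (v * y)) ⟩
          χ (u * x) ℤ.* (± (h x y) ℤ.* χ (v * y))          ∎

      -- After the substitution y = P x s the value of `h` depends on `R s` only.
      rowSum-≢0 : ∀ u v {x} → x ≢ 0# → rowSum u v x ≡ χ (u * x) ℤ.* S (ind Γ) (v * P x)
      rowSum-≢0 u v {x} x≢0 = trans (rowSum-χ u v x) (cong (χ (u * x) ℤ.*_) (begin
        ∑ (λ y → ± (h x y) ℤ.* χ (v * y))
          ≡⟨ ∑-reindex (P x *_) (inv (P x) *_) (λ s → inv-cancel′ s Px≢0) (λ s → inv-cancel s Px≢0) _ ⟩
        ∑ (λ s → ± (h x (P x * s)) ℤ.* χ (v * (P x * s)))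
          ≡⟨ ∑-cong (λ s → cong₂ (λ b z → ± b ℤ.* χ z) (value s) (sym (*-assoc v (P x) s))) ⟩
        S (ind Γ) (v * P x)                                ∎))
        where
        Px≢0 : P x ≢ 0#
        Px≢0 = P-≢0 x≢0
        value : ∀ s → h x (P x * s) ≡ does (R s ∈? Γ)
        value s = trans (h≡ x _) (trans (spread-≢0 P Γ ε x≢0 _)
          (cong (λ z → does (R z ∈? Γ)) (trans (cong (_* inv (P x)) (*-comm (P x) s)) (inv-cancelʳ′ s Px≢0))))

      rowSum-0# : ∀ u v → rowSum u v 0# ≡ ± ε ℤ.* ∑ (λ y → χ (v * y))
      rowSum-0# u v = begin
        rowSum u v 0#
          ≡⟨ rowSum-χ u v 0# ⟩
        χ (u * 0#) ℤ.* ∑ (λ y → ± (h 0# y) ℤ.* χ (v * y))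
          ≡⟨ cong₂ ℤ._*_ (trans (cong χ (zeroʳ u)) χ-0#)
               (∑-cong (λ y → cong (λ b → ± b ℤ.* χ (v * y)) (trans (h≡ 0# y) (spread-≡0 P Γ ε refl y)))) ⟩
        1ℤ ℤ.* ∑ (λ y → ± ε ℤ.* χ (v * y))
          ≡⟨ trans (ℤ.*-identityˡ _) (sym (∑-* (± ε) _)) ⟩
        ± ε ℤ.* ∑ (λ y → χ (v * y))                  ∎

      -- Each row off the axis contains the factor `S (ind Γ) 0#`, which vanishes, so the axis row
      -- alone remains.
      Walsh-v≡0 : ∀ u {v} → v ≡ 0# → Walsh F h u v ≡ ℤ.+ (2 ^ m) ℤ.* ± ε
      Walsh-v≡0 u {v} v≡0 = begin
        ∑ (rowSum u v)                  ≡⟨ ∑-point _ 0# vanish ⟩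
        rowSum u v 0#                   ≡⟨ rowSum-0# u v ⟩
        ± ε ℤ.* ∑ (λ y → χ (v * y))     ≡⟨ cong (± ε ℤ.*_) (∑-χ-≡0 v≡0) ⟩
        ± ε ℤ.* ℤ.+ (2 ^ m)             ≡⟨ ℤ.*-comm (± ε) _ ⟩
        ℤ.+ (2 ^ m) ℤ.* ± ε             ∎
        where
        vanish : ∀ x → x ≢ 0# → rowSum u v x ≡ 0ℤ
        vanish x x≢0 = begin
          rowSum u v x                            ≡⟨ rowSum-≢0 u v x≢0 ⟩
          χ (u * x) ℤ.* S (ind Γ) (v * P x)
            ≡⟨ cong (λ w → χ (u * x) ℤ.* S (ind Γ) w) (trans (cong (_* P x) v≡0) (zeroˡ _)) ⟩
          χ (u * x) ℤ.* S (ind Γ) 0#              ≡⟨ cong (χ (u * x) ℤ.*_) (S-0# good) ⟩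
          χ (u * x) ℤ.* 0ℤ                        ≡⟨ ℤ.*-zeroʳ (χ (u * x)) ⟩
          0ℤ                                      ∎

      -- Substituting x = Q (w / v) turns v P x into w; only the w in the subfield contribute,
      -- and for them Q w is a Frobenius power, which the trace moves to the other factor.
      Walsh-v≢0 : ∀ u {v} → v ≢ 0# → Walsh F h u v ≡ ℤ.+ (2 ^ m) ℤ.* ind Γ (R (frob i (u * Q (inv v))))
      Walsh-v≢0 u {v} v≢0 = begin
        ∑ (rowSum u v)
          ≡⟨ ∑-cong row ⟩
        ∑ (λ x → χ (u * x) ℤ.* S (ind Γ) (v * P x))
          ≡⟨ ∑-reindex (λ w → Q (inv v * w)) (λ x → v * P x)
               vP (λ x → trans (cong Q (inv-cancel′ (P x) v≢0)) (Q-P x)) _ ⟩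
        ∑ (λ w → χ (u * Q (inv v * w)) ℤ.* S (ind Γ) (v * P (Q (inv v * w))))
          ≡⟨ ∑-cong (λ w → trans (cong (λ z → χ (u * Q (inv v * w)) ℤ.* S (ind Γ) z) (vP w)) (onSubfield w)) ⟩
        ∑ (λ w → χ (c * w) ℤ.* S (ind Γ) w)
          ≡⟨ ∑-cong (λ w → trans (∑-* (χ (c * w)) _) (∑-cong (merge w))) ⟩
        ∑ (λ w → ∑ (λ s → ind Γ (R s) ℤ.* χ ((s + c) * w)))
          ≡⟨ ∑-swap _ ⟩
        ∑ (λ s → ∑ (λ w → ind Γ (R s) ℤ.* χ ((s + c) * w)))
          ≡⟨ ∑-cong (λ s → sym (∑-* (ind Γ (R s)) _)) ⟩
        ∑ (λ s → ind Γ (R s) ℤ.* ∑ (λ w → χ ((s + c) * w)))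
          -- By orthogonality the inner sum vanishes unless `s + c` is zero, that is, unless `s` is
          -- `c`.
          ≡⟨ ∑-point _ c (λ s s≢c → trans (cong (ind Γ (R s) ℤ.*_) (∑-χ-≢0 (s≢c ∘ +≡0⇒≡))) (ℤ.*-zeroʳ (ind Γ (R s)))) ⟩
        ind Γ (R c) ℤ.* ∑ (λ w → χ ((c + c) * w))
          ≡⟨ cong (ind Γ (R c) ℤ.*_) (∑-χ-≡0 (char2 c)) ⟩
        ind Γ (R c) ℤ.* ℤ.+ (2 ^ m)
          ≡⟨ ℤ.*-comm (ind Γ (R c)) _ ⟩
        ℤ.+ (2 ^ m) ℤ.* ind Γ (R c)                      ∎
        where
        open CommutativeSemigroupProperties ℤ.*-commutativeSemigroup using (x∙yz≈y∙xz)
        c : Carrier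
        c = frob i (u * Q (inv v))
        vP : ∀ w → v * P (Q (inv v * w)) ≡ w
        vP w = trans (cong (v *_) (P-Q _)) (inv-cancel w v≢0)
        -- The formula extends to the axis: there the left side is a full sum of a nontrivial
        -- character, as `v` is nonzero, and the right side contains `S (ind Γ) 0#`; both are zero.
        row : ∀ x → rowSum u v x ≡ χ (u * x) ℤ.* S (ind Γ) (v * P x)
        row x with x ≟ 0#
        ... | no x≢0 = rowSum-≢0 u v x≢0
        ... | yes refl = begin
          rowSum u v 0#                            ≡⟨ rowSum-0# u v ⟩
          ± ε ℤ.* ∑ (λ y → χ (v * y))              ≡⟨ cong (± ε ℤ.*_) (∑-χ-≢0 v≢0) ⟩
          ± ε ℤ.* 0ℤ                               ≡⟨ ℤ.*-zeroʳ (± ε) ⟩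
          0ℤ                                       ≡⟨ ℤ.*-zeroʳ (χ (u * 0#)) ⟨
          χ (u * 0#) ℤ.* 0ℤ                        ≡⟨ cong (χ (u * 0#) ℤ.*_) (S-0# good) ⟨
          χ (u * 0#) ℤ.* S (ind Γ) 0#
            ≡⟨ cong (λ w → χ (u * 0#) ℤ.* S (ind Γ) w) (trans (cong (v *_) P-0#) (zeroʳ v)) ⟨
          χ (u * 0#) ℤ.* S (ind Γ) (v * P 0#)      ∎
        onSubfield : ∀ w → χ (u * Q (inv v * w)) ℤ.* S (ind Γ) w ≡ χ (c * w) ℤ.* S (ind Γ) w
        onSubfield w with frob k w ≟ w
        ... | no w∉  = trans (cong (χ (u * Q (inv v * w)) ℤ.*_) (S-outside (ind Γ) w∉))
          (trans (ℤ.*-zeroʳ (χ (u * Q (inv v * w))))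
            (sym (trans (cong (χ (c * w) ℤ.*_) (S-outside (ind Γ) w∉)) (ℤ.*-zeroʳ (χ (c * w))))))
        ... | yes w∈ = cong (ℤ._* S (ind Γ) w) (begin
          χ (u * Q (inv v * w))
            ≡⟨ cong (λ z → χ (u * z)) (trans (Q-* (inv v) w) (cong (Q (inv v) *_) (Q-subfield w∈))) ⟩
          χ (u * (Q (inv v) * frob j w))       ≡⟨ cong χ (*-assoc u _ _) ⟨
          -- Applying `frob i` inside the character undoes `frob j` on `w` and turns the other
          -- factor into `c`.
          χ (u * Q (inv v) * frob j w)         ≡⟨ χ-frob i _ ⟨
          χ (frob i (u * Q (inv v) * frob j w)) ≡⟨ cong χ (frob-* i _ _) ⟩
          χ (c * frob i (frob j w))
            ≡⟨ cong (λ z → χ (c * z)) (frob-inverse j i (trans (ℕ.+-comm j i) i+j≡m) w) ⟩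
          χ (c * w)                            ∎)
        merge : ∀ w s → χ (c * w) ℤ.* (ind Γ (R s) ℤ.* χ (w * s)) ≡ ind Γ (R s) ℤ.* χ ((s + c) * w)
        merge w s = begin
          χ (c * w) ℤ.* (ind Γ (R s) ℤ.* χ (w * s))  ≡⟨ x∙yz≈y∙xz (χ (c * w)) (ind Γ (R s)) (χ (w * s)) ⟩
          ind Γ (R s) ℤ.* (χ (c * w) ℤ.* χ (w * s))  ≡⟨ cong (ind Γ (R s) ℤ.*_) (χ-+ _ _) ⟨
          ind Γ (R s) ℤ.* χ (c * w + w * s)
            ≡⟨ cong (λ z → ind Γ (R s) ℤ.* χ z) (trans (+-comm _ _) (trans (cong (_+ c * w) (*-comm w s)) (sym (distribʳ w s c)))) ⟩
          ind Γ (R s) ℤ.* χ ((s + c) * w)            ∎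

      -- The preimage of `Γ` under `frob i`, given as an image under its inverse so that uniqueness
      -- and length carry over.
      dualΓ : List Carrier
      dualΓ = map (frob j) Γ

      frob-i-inverse : ∀ x → frob j (frob i x) ≡ x
      frob-i-inverse = frob-inverse i j i+j≡m

      frob-j-inverse : ∀ x → frob i (frob j x) ≡ x
      frob-j-inverse = frob-inverse j i (trans (ℕ.+-comm j i) i+j≡m)

      dualΓ-good : GoodΓ F k dualΓ
      dualΓ-good =
          Unique.map⁺ (λ {x} {y} eq → trans (sym (frob-j-inverse x)) (trans (cong (frob i) eq) (frob-j-inverse y))) (proj₁ good)
        , All.map⁺ (All.map (frob-InSubfield j) (proj₁ (proj₂ good)))
        , trans (List.length-map (frob j) Γ) (proj₂ (proj₂ good))

      ∈-dualΓ : ∀ y → does (frob i y ∈? Γ) ≡ does (y ∈? dualΓ)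
      ∈-dualΓ y with frob i y ∈? Γ
      ... | yes fy∈Γ =
        sym (dec-true (y ∈? dualΓ) (subst (_∈ dualΓ) (frob-i-inverse y) (∈-map⁺ (frob j) fy∈Γ)))
      ... | no  fy∉Γ = sym (dec-false (y ∈? dualΓ) λ y∈ →
        let γ , γ∈Γ , y≡ = ∈-map⁻ (frob j) y∈
        in fy∉Γ (subst (_∈ Γ) (trans (sym (frob-j-inverse γ)) (cong (frob i) (sym y≡))) γ∈Γ))

      -- The trace commutes with `frob i`, which is then absorbed into the set of trace values. The
      -- result again has spread shape, with `Q` for `P` and the arguments exchanged; bentness and
      -- the form of the dual are both read off from it.
      Walsh-spread : ∀ u v → Walsh F h u v ≡ ℤ.+ (2 ^ m) ℤ.* ± (spread Q dualΓ ε v u)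
      Walsh-spread u v with v ≟ 0#
      ... | yes v≡0 = Walsh-v≡0 u v≡0
      ... | no  v≢0 = trans (Walsh-v≢0 u v≢0) (cong (λ b → ℤ.+ (2 ^ m) ℤ.* ± b) (begin
        does (R (frob i (u * Q (inv v))) ∈? Γ)     ≡⟨ cong (λ z → does (z ∈? Γ)) (frob-R i _) ⟨
        does (frob i (R (u * Q (inv v))) ∈? Γ)     ≡⟨ ∈-dualΓ _ ⟩
        does (R (u * Q (inv v)) ∈? dualΓ)          ≡⟨ cong (λ z → does (R (u * z) ∈? dualΓ)) (Q-inv v≢0) ⟩
        does (R (u * inv (Q v)) ∈? dualΓ)          ∎))

      spread-bent : Bent F h
      spread-bent u v = begin
        ℤ.∣ Walsh F h u v ∣                                  ≡⟨ cong ℤ.∣_∣ (Walsh-spread u v) ⟩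
        ℤ.∣ ℤ.+ (2 ^ m) ℤ.* ± (spread Q dualΓ ε v u) ∣
          ≡⟨ ℤ.abs-* (ℤ.+ (2 ^ m)) (± (spread Q dualΓ ε v u)) ⟩
        2 ^ m ℕ.* ℤ.∣ ± (spread Q dualΓ ε v u) ∣
          ≡⟨ cong (2 ^ m ℕ.*_) (∣±∣ (spread Q dualΓ ε v u)) ⟩
        2 ^ m ℕ.* 1                                          ≡⟨ ℕ.*-identityʳ _ ⟩
        2 ^ m                                                ∎

      -- Since `2 ^ m` is nonzero and `±` is injective, the Walsh values determine a dual at every
      -- point.
      spread-dual : ∀ g → IsDual F h g → ∀ u v → g u v ≡ spread Q dualΓ ε v u
      spread-dual g dual u v = ±-injective (ℤ.*-cancelˡ-≡ (ℤ.+ (2 ^ m)) _ _ {{ℕ.m^n≢0 2 m}} (begin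
        ℤ.+ (2 ^ m) ℤ.* ± (g u v)                       ≡⟨ cong (ℤ.+ (2 ^ m) ℤ.*_) (sign-0# (g u v)) ⟨
        ℤ.+ (2 ^ m) ℤ.* sign F (g u v) 0#               ≡⟨ dual u v ⟨
        Walsh F h u v                                   ≡⟨ Walsh-spread u v ⟩
        ℤ.+ (2 ^ m) ℤ.* ± (spread Q dualΓ ε v u)        ∎))

    -- The two classes

    -- x^(2^k+1) is a permutation because d (2^k+1) ≡ -1 modulo 2^m-1; on the subfield it is the squaring map.
    module Classes (d : ℕ) (N∣ : 2 ^ m ∸ 1 ∣ suc (d ℕ.* (2 ^ k ℕ.+ 1))) where

      powP powQ : Carrier → Carrier
      powP x = x ↑ (2 ^ k ℕ.+ 1)
      -- This is x^(-d) extended by 0; `GF2^` leaves `inv 0#` unspecified, so the value at 0 is set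
      -- separately.
      powQ x = if does (x ≟ 0#) then 0# else inv x ↑ d

      powP-0# : powP 0# ≡ 0#
      powP-0# = trans (↑-+ 0# (2 ^ k) 1) (trans (cong (frob k 0# *_) (zeroˡ 1#)) (zeroʳ _))

      powQ-0# : powQ 0# ≡ 0#
      powQ-0# = cong (λ b → if b then 0# else inv 0# ↑ d) (dec-true (0# ≟ 0#) refl)

      powQ-≢0 : ∀ {x} → x ≢ 0# → powQ x ≡ inv x ↑ d
      powQ-≢0 {x} x≢0 = cong (λ b → if b then 0# else inv x ↑ d) (dec-false (x ≟ 0#) x≢0)

      -- By Fermat the power of `inv x` with exponent 1 + d (2^k + 1) is 1, so splitting off one
      -- factor leaves the inverse of `inv x`.
      inv-↑-root : ∀ {x} → x ≢ 0# → inv x ↑ (d ℕ.* (2 ^ k ℕ.+ 1)) ≡ x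
      inv-↑-root {x} x≢0 = trans (inv-unique (begin
        inv x ↑ suc (d ℕ.* (2 ^ k ℕ.+ 1))       ≡⟨ cong (inv x ↑_) (_∣_.equality N∣) ⟩
        inv x ↑ (_∣_.quotient N∣ ℕ.* (2 ^ m ∸ 1))  ≡⟨ ↑-* (inv x) (_∣_.quotient N∣) _ ⟩
        (inv x ↑ _∣_.quotient N∣) ↑ (2 ^ m ∸ 1)    ≡⟨ fermat (↑-≢0 (_∣_.quotient N∣) (inv-≢0 x≢0)) ⟩
        1#                                      ∎)) (sym (inv-unique (inv-l x≢0)))

      powP-powQ : ∀ x → powP (powQ x) ≡ x
      powP-powQ x with x ≟ 0#
      ... | yes refl = powP-0#
      ... | no  x≢0  = trans (sym (↑-* (inv x) d (2 ^ k ℕ.+ 1))) (inv-↑-root x≢0)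

      powQ-powP : ∀ x → powQ (powP x) ≡ x
      powQ-powP x with x ≟ 0#
      ... | yes refl = trans (cong powQ powP-0#) powQ-0#
      ... | no  x≢0  = begin
        powQ (powP x)                      ≡⟨ powQ-≢0 (↑-≢0 (2 ^ k ℕ.+ 1) x≢0) ⟩
        inv (powP x) ↑ d                   ≡⟨ cong (_↑ d) (inv-↑ (2 ^ k ℕ.+ 1) x≢0) ⟩
        (inv x ↑ (2 ^ k ℕ.+ 1)) ↑ d        ≡⟨ ↑-* (inv x) (2 ^ k ℕ.+ 1) d ⟨
        inv x ↑ ((2 ^ k ℕ.+ 1) ℕ.* d)      ≡⟨ cong (inv x ↑_) (ℕ.*-comm (2 ^ k ℕ.+ 1) d) ⟩
        inv x ↑ (d ℕ.* (2 ^ k ℕ.+ 1))      ≡⟨ inv-↑-root x≢0 ⟩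
        x                                  ∎

      pairing : Pairing
      pairing = record
        -- On the subfield x^(2^k) = x, so `powP` squares there and `i` is 1; the complementary
        -- power `j` takes square roots.
        { P = powP ; Q = powQ ; i = 1 ; j = ℕ.pred m
        ; i+j≡m = ℕ.suc-pred m {{ℕ.≢-nonZero m≢0}}
        ; P-0# = powP-0# ; Q-0# = powQ-0# ; Q-P = powQ-powP ; P-Q = powP-powQ
        ; P-* = λ x y → *-↑ x y (2 ^ k ℕ.+ 1)
        -- Multiplicativity passes from `powP` to its inverse, which avoids case distinctions at
        -- zero.
        ; Q-* = λ x y → begin
            powQ (x * y)                          ≡⟨ cong powQ (cong₂ _*_ (powP-powQ x) (powP-powQ y)) ⟨
            powQ (powP (powQ x) * powP (powQ y))  ≡⟨ cong powQ (*-↑ (powQ x) (powQ y) (2 ^ k ℕ.+ 1)) ⟨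
            powQ (powP (powQ x * powQ y))         ≡⟨ powQ-powP _ ⟩
            powQ x * powQ y                       ∎
        -- `frob 1 w` unfolds to `w * w ↑ 1`.
        ; P-subfield = λ {w} w∈ → trans (↑-+ w (2 ^ k) 1) (cong (_* w ↑ 1) w∈)
        }

      open Pairing pairing using (P-≢0; Q-≢0)

      -- A point with nonzero `x` determines its parameter s = y / P x, so membership in the union
      -- over `Γ` only tests the trace of that quotient.
      Region : (Carrier → Carrier) → List Carrier → Carrier → Carrier → Set
      Region P Γ x y = x ≢ 0# × R (y * inv (P x)) ∈ Γ

      InA⇔Region : ∀ {Γ x y} → (∃[ γ ] (γ ∈ Γ × InA F k (suc n) γ x y)) ⇔ Region powP Γ x y
      InA⇔Region {Γ} {x} {y} = mk⇔
        (λ { (γ , γ∈Γ , s , refl , _ , x≢0 , refl , refl) →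
             x≢0 , subst (λ z → R z ∈ Γ) (sym (inv-cancelʳ′ s (P-≢0 x≢0))) γ∈Γ })
        (λ { (x≢0 , R∈Γ) →
             _ , R∈Γ , _ , refl , x , x≢0 , refl , sym (inv-cancelʳ y (P-≢0 x≢0)) })

      InB⇔Region : ∀ {Γ x y} → (∃[ γ ] (γ ∈ Γ × InB F k (suc n) d γ y x)) ⇔ Region powQ Γ x y
      InB⇔Region {Γ} {x} {y} = mk⇔
        (λ { (γ , γ∈Γ , s , refl , _ , x≢0 , refl , refl) →
             x≢0 , subst (λ z → R z ∈ Γ)
               (sym (trans (cong (λ z → z * s * inv (powQ x)) (sym (powQ-≢0 x≢0)))
                 (trans (cong (_* inv (powQ x)) (*-comm (powQ x) s)) (inv-cancelʳ′ s (Q-≢0 x≢0)))))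
               γ∈Γ })
        (λ { (x≢0 , R∈Γ) →
             _ , R∈Γ , _ , refl , x , x≢0 ,
             sym (trans (cong (_* (y * inv (powQ x))) (sym (powQ-≢0 x≢0)))
                   (trans (*-comm (powQ x) _) (inv-cancelʳ y (Q-≢0 x≢0)))) ,
             refl })

      spread-false⇔ : ∀ P Γ x y → spread P Γ false x y ≡ true ⇔ Region P Γ x y
      spread-false⇔ P Γ x y with x ≟ 0#
      ... | yes x≡0 = mk⇔ (λ ()) (λ (x≢0 , _) → contradiction x≡0 x≢0)
      ... | no  x≢0 with R (y * inv (P x)) ∈? Γ
      ...   | yes ∈Γ = mk⇔ (λ _ → x≢0 , ∈Γ) (λ _ → refl)
      ...   | no  ∉Γ = mk⇔ (λ ()) (λ (_ , ∈Γ) → contradiction ∈Γ ∉Γ)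

      spread-true⇔ : ∀ P Γ x y → spread P Γ true x y ≡ true ⇔ (x ≡ 0# ⊎ Region P Γ x y)
      spread-true⇔ P Γ x y with x ≟ 0#
      ... | yes x≡0 = mk⇔ (λ _ → inj₁ x≡0) (λ _ → refl)
      ... | no  x≢0 with R (y * inv (P x)) ∈? Γ
      ...   | yes ∈Γ = mk⇔ (λ _ → inj₂ (x≢0 , ∈Γ)) (λ _ → refl)
      ...   | no  ∉Γ = mk⇔ (λ ()) [ (λ x≡0 → contradiction x≡0 x≢0) , (λ (_ , ∈Γ) → contradiction ∈Γ ∉Γ) ]′

      IsSpread : (Carrier → Carrier) → BoolFun F → Set
      IsSpread P h = ∃[ Γ ] (GoodΓ F k Γ × ∃[ ε ] (∀ x y → h x y ≡ spread P Γ ε x y))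

      ClassI⇒IsSpread : ∀ {h} → ClassI F k (suc n) h → IsSpread powP h
      ClassI⇒IsSpread (Γ , good , inj₁ supp) = Γ , good , false , λ x y →
        support⇒≡ (supp x y) InA⇔Region (spread-false⇔ powP Γ x y)
      ClassI⇒IsSpread (Γ , good , inj₂ supp) = Γ , good , true , λ x y →
        support⇒≡ (supp x y) (⇔-refl ⊎-⇔ InA⇔Region) (spread-true⇔ powP Γ x y)

      IsSpread⇒ClassI : ∀ {h} → IsSpread powP h → ClassI F k (suc n) h
      IsSpread⇒ClassI (Γ , good , false , h≡) = Γ , good , inj₁ λ x y →
        ≡⇒support (h≡ x y) InA⇔Region (spread-false⇔ powP Γ x y)
      IsSpread⇒ClassI (Γ , good , true  , h≡) = Γ , good , inj₂ λ x y →
        ≡⇒support (h≡ x y) (⇔-refl ⊎-⇔ InA⇔Region) (spread-true⇔ powP Γ x y)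

      ClassII⇒IsSpread : ∀ {h} → ClassII F k (suc n) d h → IsSpread powQ (flip h)
      ClassII⇒IsSpread (Γ , good , inj₁ supp) = Γ , good , false , λ x y →
        support⇒≡ (supp y x) InB⇔Region (spread-false⇔ powQ Γ x y)
      ClassII⇒IsSpread (Γ , good , inj₂ supp) = Γ , good , true , λ x y →
        support⇒≡ (supp y x) (⇔-refl ⊎-⇔ InB⇔Region) (spread-true⇔ powQ Γ x y)

      IsSpread⇒ClassII : ∀ {h} → IsSpread powQ (flip h) → ClassII F k (suc n) d h
      IsSpread⇒ClassII (Γ , good , false , h≡) = Γ , good , inj₁ λ x y →
        ≡⇒support (h≡ y x) InB⇔Region (spread-false⇔ powQ Γ y x)
      IsSpread⇒ClassII (Γ , good , true  , h≡) = Γ , good , inj₂ λ x y →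
        ≡⇒support (h≡ y x) (⇔-refl ⊎-⇔ InB⇔Region) (spread-true⇔ powQ Γ y x)

      bentI : ∀ h → ClassI F k (suc n) h → Bent F h × (∀ g → IsDual F h g → ClassII F k (suc n) d g)
      bentI h h∈ = let Γ , good , ε , h≡ = ClassI⇒IsSpread h∈ in
        spread-bent pairing good ε h≡ ,
        λ g dual → IsSpread⇒ClassII
          (_ , dualΓ-good pairing good ε h≡ , ε , λ x y → spread-dual pairing good ε h≡ g dual y x)

      -- Flipping the coordinates gives a spread function for `powQ`. The flipped pairing makes its
      -- dual, also flipped, a spread function for `powP` with arguments exchanged, and the two
      -- exchanges cancel.
      bentII : ∀ h → ClassII F k (suc n) d h → Bent F h × (∀ g → IsDual F h g → ClassI F k (suc n) g)
      bentII h h∈ = let Γ , good , ε , h≡ = ClassII⇒IsSpread h∈ in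
        (λ u v → trans (cong ℤ.∣_∣ (sym (Walsh-flip h u v))) (spread-bent (flipPairing pairing) good ε h≡ v u)) ,
        λ g dual → IsSpread⇒ClassI
          (_ , dualΓ-good (flipPairing pairing) good ε h≡ , ε , λ x y →
            spread-dual (flipPairing pairing) good ε h≡ (flip g) (λ u v → trans (Walsh-flip h v u) (dual v u)) y x)

-- The theorem for a divisor `k` of `m`

open import Data.Integer using (+_)

theorem13 : (m k : ℕ) .{{_ : NonZero k}} → k ∣ m
    → gcd (2 ^ m ∸ 1) (2 ^ k Data.Nat.+ 1) ≡ 1
    → (d : ℕ)
    → (+ (2 ^ m ∸ 1)) ℤD.∣ ((+ d) ℤ.* ((+ (2 ^ m)) ℤ.- (+ (2 ^ k)) ℤ.- (+ 2)) ℤ.- (+ 1))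
    → (F : GF2^ m)
    → (∀ h → ClassI F k (m / k) h
    → Bent F h × (∀ g → IsDual F h g → ClassII F k (m / k) d g))
    × (∀ h → ClassII F k (m / k) d h
    → Bent F h × (∀ g → IsDual F h g → ClassI F k (m / k) g))
-- Quotient zero would force `m` to be 0, which no field allows.
theorem13 m k (divides zero    m≡0) _ d N∣ F = contradiction m≡0 (FiniteField.m≢0 F)
theorem13 m k (divides (suc n) m≡)  _ d N∣ F = subst
  (λ l → (∀ h → ClassI F k l h → Bent F h × (∀ g → IsDual F h g → ClassII F k l d g))
       × (∀ h → ClassII F k l d h → Bent F h × (∀ g → IsDual F h g → ClassI F k l g)))
  -- `m / k` is replaced by `suc n`, the form that isolates the top summand of the relative trace.
  (sym (trans (ℕ./-congˡ m≡) (ℕ.m*n/n≡m (suc n) k)))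
  (bentI , bentII)
  where
  open FiniteField.Spread F k n (trans (ℕ.*-comm k (suc n)) (sym m≡))
  -- `exponent-∣` takes the field order as a successor, so that no truncated subtraction enters the
  -- integer identity.
  2^m : 2 ^ m ≡ suc (2 ^ m ∸ 1)
  2^m = sym (ℕ.suc-pred (2 ^ m) {{ℕ.m^n≢0 2 m}})
  open Classes d (exponent-∣ (2 ^ m ∸ 1) (2 ^ k) d
    (subst (λ l → (+ (2 ^ m ∸ 1)) ℤD.∣ ((+ d) ℤ.* ((+ l) ℤ.- (+ (2 ^ k)) ℤ.- (+ 2)) ℤ.- (+ 1))) 2^m N∣))
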